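{- Let $\boldsymbol{\mu}=(\mu_1,\ldots,\mu_n)$ be an $n$-tuple of umbral monomials with generating function $f(\boldsymbol{\mu},\boldsymbol{t})$ and let $\boldsymbol{\nu}=(\nu_1,\ldots,\nu_n)$ be an $n$-tuple of umbral monomials with generating function $f(\boldsymbol{\nu},\boldsymbol{t})$, where $\boldsymbol{t}=(t_1,\dots,t_n)$. Then the auxiliary umbra $(\mu_1+\cdots+\mu_n)\boldsymbol{.}\beta\boldsymbol{.}\boldsymbol{\nu}$ has generating function $$f[(\mu_1+\cdots+\mu_n)\boldsymbol{.}\beta\boldsymbol{.}\boldsymbol{\nu},\,\boldsymbol{t}]=f[\boldsymbol{\mu},(f(\boldsymbol{\nu},\boldsymbol{t})-1,\ldots,f(\boldsymbol{\nu},\boldsymbol{t})-1)],$$ an identity of formal power series in $t_1,\dots,t_n$.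
   Context: $R$ is the real or complex field, $A$ is a set (the alphabet) whose elements are called umbrae, and $E:R[A]\to R$ is a linear functional (evaluation) with $E[1]=1$ and $E[\alpha^i\gamma^j\cdots]=E[\alpha^i]E[\gamma^j]\cdots$ for distinct umbrae and nonnegative integers $i,j,\dots$. An $n$-tuple $\boldsymbol{\mu}=(\mu_1,\dots,\mu_n)$ of umbral monomials (monomials in $R[A]$, supports not necessarily disjoint) has multivariate moments $E[\boldsymbol{\mu}^{\boldsymbol{i}}]$, $\boldsymbol{\mu}^{\boldsymbol{i}}=\mu_1^{i_1}\cdots\mu_n^{i_n}$, $\boldsymbol{i}\in\mathbb{N}_0^n$, and generating function $f(\boldsymbol{\mu},\boldsymbol{t})=1+\sum_{\boldsymbol{i}\neq\boldsymbol{0}}E[\boldsymbol{\mu}^{\boldsymbol{i}}]\,\boldsymbol{t}^{\boldsymbol{i}}/\boldsymbol{i}!$ with $\boldsymbol{i}!=i_1!\cdots i_n!$, $\boldsymbol{t}^{\boldsymbol{i}}=t_1^{i_1}\cdots t_n^{i_n}$. For formal power series $s_1,\dots,s_n$ without constant term, $f[\boldsymbol{\mu},(s_1,\dots,s_n)]$ denotes the substitution $t_j\mapsto s_j$ in $f(\boldsymbol{\mu},\boldsymbol{t})$. Partitions of a multi-index: a partition $\boldsymbol{\lambda}$ of $\boldsymbol{i}\in\mathbb{N}_0^n$, written $\boldsymbol{\lambda}\vdash\boldsymbol{i}$, is a matrix of nonnegative integers with $n$ rows, no zero column, columns in lexicographic order, and $r$-th row sum equal to $i_r$ for $r=1,\dots,n$.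 Its number of columns is $l(\boldsymbol{\lambda})$. Writing $\boldsymbol{\lambda}=(\boldsymbol{\lambda}_1^{r_1},\boldsymbol{\lambda}_2^{r_2},\dots)$ when the distinct column $\boldsymbol{\lambda}_j$ occurs $r_j$ times, set $\mathfrak{m}(\boldsymbol{\lambda})!=r_1!r_2!\cdots$ and $\boldsymbol{\lambda}!=\prod_j(\boldsymbol{\lambda}_j!)^{r_j}$ (product of factorials of all entries). With $h_{\boldsymbol{j}}=E[\boldsymbol{\nu}^{\boldsymbol{j}}]$ set $h_{\boldsymbol{\lambda}}=h_{\boldsymbol{\lambda}_1}^{r_1}h_{\boldsymbol{\lambda}_2}^{r_2}\cdots$. The auxiliary umbra $p\boldsymbol{.}\beta\boldsymbol{.}\boldsymbol{\nu}$ ($\beta$ denotes the Bell umbra), for an umbral polynomial $p\in R[A]$ (here $p=\mu_1+\cdots+\mu_n$), is the symbolic tuple defined by its moments $$E[(p\boldsymbol{.}\beta\boldsymbol{.}\boldsymbol{\nu})^{\boldsymbol{i}}]=\sum_{\boldsymbol{\lambda}\vdash\boldsymbol{i}}\frac{\boldsymbol{i}!}{\mathfrak{m}(\boldsymbol{\lambda})!\,\boldsymbol{\lambda}!}\,E[p^{\,l(\boldsymbol{\lambda})}]\,h_{\boldsymbol{\lambda}},$$ and its generating function is $1+\sum_{\boldsymbol{i}\ne\boldsymbol{0}}E[(p\boldsymbol{.}\beta\boldsymbol{.}\boldsymbol{\nu})^{\boldsymbol{i}}]\,\boldsymbol{t}^{\boldsymbol{i}}/\boldsymbol{i}!$. 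-}

module Defs where

open import Level as Level using (_⊔_)
open import Algebra.Bundles using (CommutativeRing; Semiring; RawSemiring)
open import Algebra.Apartness.Bundles using (HeytingField; HeytingCommutativeRing)
import Algebra.Definitions.RawSemiring as RawSemiringDefs
import Algebra.Properties.CommutativeSemigroup as CommutativeSemigroupProperties
open import Algebra.Module.Bundles using (RawLeftModule)
open import Algebra.Module.Morphism.Structures using (module LeftModuleMorphisms)
import Algebra.Module.Construct.TensorUnit as TensorUnit
open import Data.Bool.Base using (if_then_else_)
open import Data.Fin.Base using (zero; suc)
open import Data.List.Base as List
  using (List; []; _∷_; map; filter; length; upTo; concatMap;
         cartesianProductWith; deduplicate)
open import Data.List.Membership.Propositional using (_∈_)
open import Data.List.Membership.Propositional.Properties
  using (∈-cartesianProductWith⁺; ∈-cartesianProductWith⁻; ∈-upTo⁺; ∈-upTo⁻;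
         ∈-filter⁺; ∈-concat⁺′; ∈-map⁺)
open import Data.List.Relation.Unary.All as All using (All; []; _∷_)
import Data.List.Relation.Unary.All.Properties as All
open import Data.List.Relation.Unary.AllPairs as AllPairs using ([]; _∷_)
import Data.List.Relation.Unary.AllPairs.Properties as AllPairs
open import Data.List.Relation.Unary.Any using (here; there)
open import Data.List.Relation.Binary.Disjoint.Propositional using (Disjoint)
import Data.List.Relation.Unary.Sorted.TotalOrder as Sorted
open import Data.List.Relation.Unary.Unique.Propositional using (Unique)
import Data.List.Relation.Unary.Unique.Propositional.Properties as Unique
open import Data.Nat.Base as ℕ using (ℕ; zero; suc; _≤_; _<_; NonZero; _!; s≤s; z≤n)
open import Data.Nat.ListAction using (product)
open import Data.Nat.ListAction.Properties using (product≢0)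
import Data.Nat.Properties as ℕ
open import Data.Product.Base using (∃-syntax; _×_; _,_; proj₁; proj₂)
open import Data.Vec.Base using (Vec; []; _∷_; lookup; replicate; zipWith; sum)
open import Data.Vec.Functional using (Vector)
open import Data.Vec.Properties using (≡-dec; ∷-injective)
import Data.Vec.Relation.Binary.Lex.NonStrict as Lex
open import Data.Vec.Relation.Binary.Pointwise.Inductive as Pointwise
  using (Pointwise; []; _∷_)
open import Relation.Binary.Bundles using (DecTotalOrder)
open import Relation.Binary.Definitions using (DecidableEquality)
open import Relation.Binary.PropositionalEquality as ≡ using (_≡_; _≢_)
open import Relation.Nullary.Decidable using (Dec; yes; no; does; ¬?; _×-dec_; dec-true)
open import Relation.Nullary.Negation using (contradiction)

------------------------------------------------------------------------
-- Multi-indices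

MultiIndex : ℕ → Set
MultiIndex = Vec ℕ

𝟎 : ∀ {n} → MultiIndex n
𝟎 {n} = replicate n 0

infix 4 _≟_

_≟_ : ∀ {n} → DecidableEquality (MultiIndex n)
_≟_ = ≡-dec ℕ._≟_

infixl 6 _⊕_ _⊖_

_⊕_ _⊖_ : ∀ {n} → MultiIndex n → MultiIndex n → MultiIndex n
_⊕_ = zipWith ℕ._+_
_⊖_ = zipWith ℕ._∸_

infix 9 _!ᵐ

_!ᵐ : ∀ {n} → MultiIndex n → ℕ
[]      !ᵐ = 1
(k ∷ i) !ᵐ = k ! ℕ.* i !ᵐ

!ᵐ-nonZero : ∀ {n} (i : MultiIndex n) → NonZero (i !ᵐ)
!ᵐ-nonZero []      = _
!ᵐ-nonZero (k ∷ i) = ℕ.m*n≢0 (k !) (i !ᵐ) {{k ℕ.!≢0}} {{ !ᵐ-nonZero i }}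

-- All j with j ≤ i componentwise.
below : ∀ {n} → MultiIndex n → List (MultiIndex n)
below []      = [] ∷ []
below (k ∷ i) = cartesianProductWith _∷_ (upTo (suc k)) (below i)

------------------------------------------------------------------------
-- Partitions of a multi-index

lexOrder : ℕ → DecTotalOrder _ _ _
lexOrder = Lex.≤-decTotalOrder ℕ.≤-decTotalOrder

-- All lists of length l with entries from xs.
words : ∀ {a} {X : Set a} → List X → ℕ → List (List X)
words xs zero    = [] ∷ []
words xs (suc l) = cartesianProductWith _∷_ xs (words xs l)

-- A matrix with n rows is represented by the list of its columns.
module _ {n : ℕ} where

  rowSums : List (MultiIndex n) → MultiIndex n
  rowSums = List.foldr _⊕_ 𝟎

  open Sorted (DecTotalOrder.totalOrder (lexOrder n)) public using (Sorted; sorted?)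

  infix 4 _⊢_ _⊢?_

  _⊢_ : List (MultiIndex n) → MultiIndex n → Set
  Λ ⊢ i = All (_≢ 𝟎) Λ × Sorted Λ × rowSums Λ ≡ i

  _⊢?_ : (Λ : List (MultiIndex n)) (i : MultiIndex n) → Dec (Λ ⊢ i)
  Λ ⊢? i = All.all? (λ c → ¬? (c ≟ 𝟎)) Λ
           ×-dec sorted? (DecTotalOrder._≤?_ (lexOrder n)) Λ
           ×-dec (rowSums Λ ≟ i)

  -- A partition of i has at most sum i columns, and each of them is ≤ i, so
  -- nothing is missed here; see ∈-partitions and partitions-unique below.
  partitions : MultiIndex n → List (List (MultiIndex n))
  partitions i = filter (_⊢? i) (concatMap (words (below i)) (upTo (suc (sum i))))

  distinct : List (MultiIndex n) → List (MultiIndex n)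
  distinct = deduplicate _≟_

  mult : MultiIndex n → List (MultiIndex n) → ℕ
  mult c Λ = length (filter (c ≟_) Λ)

  𝔪[_]! : List (MultiIndex n) → ℕ
  𝔪[ Λ ]! = product (map (λ c → mult c Λ !) (distinct Λ))

  infix 9 _!ᵖ

  _!ᵖ : List (MultiIndex n) → ℕ
  Λ !ᵖ = product (map (λ c → (c !ᵐ) ℕ.^ mult c Λ) (distinct Λ))

  𝔪!-nonZero : ∀ Λ → NonZero 𝔪[ Λ ]!
  𝔪!-nonZero Λ = product≢0 (All.map⁺ (All.universal (λ c → mult c Λ ℕ.!≢0) (distinct Λ)))

  !ᵖ-nonZero : ∀ Λ → NonZero (Λ !ᵖ)
  !ᵖ-nonZero Λ = product≢0 (All.map⁺ (All.universal
    (λ c → ℕ.m^n≢0 (c !ᵐ) (mult c Λ) {{ !ᵐ-nonZero c }}) (distinct Λ)))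

  𝔪!*!ᵖ-nonZero : ∀ Λ → NonZero (𝔪[ Λ ]! ℕ.* Λ !ᵖ)
  𝔪!*!ᵖ-nonZero Λ = ℕ.m*n≢0 𝔪[ Λ ]! (Λ !ᵖ) {{ 𝔪!-nonZero Λ }} {{ !ᵖ-nonZero Λ }}

------------------------------------------------------------------------
-- The enumerations are complete and free of repetitions.

∈-below⁺ : ∀ {n} {j i : MultiIndex n} → Pointwise _≤_ j i → j ∈ below i
∈-below⁺ []       = here ≡.refl
∈-below⁺ (p ∷ ps) = ∈-cartesianProductWith⁺ _∷_ (∈-upTo⁺ (s≤s p)) (∈-below⁺ ps)

∈-below⁻ : ∀ {n} {j : MultiIndex n} (i : MultiIndex n) → j ∈ below i → Pointwise _≤_ j i
∈-below⁻ {j = []} [] _ = []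
∈-below⁻ (k ∷ i) j∈
  with _ , _ , a∈ , b∈ , ≡.refl ← ∈-cartesianProductWith⁻ _∷_ (upTo (suc k)) (below i) j∈
  = ℕ.s≤s⁻¹ (∈-upTo⁻ a∈) ∷ ∈-below⁻ i b∈

below-unique : ∀ {n} (i : MultiIndex n) → Unique (below i)
below-unique []      = [] ∷ []
below-unique (k ∷ i) =
  Unique.cartesianProductWith⁺ _∷_ ∷-injective (Unique.upTo⁺ (suc k)) (below-unique i)

sum-⊕ : ∀ {n} (i j : MultiIndex n) → sum (i ⊕ j) ≡ sum i ℕ.+ sum j
sum-⊕ []      []      = ≡.refl
sum-⊕ (a ∷ i) (b ∷ j) = ≡.trans (≡.cong (a ℕ.+ b ℕ.+_) (sum-⊕ i j))
                                (interchange a b (sum i) (sum j))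
  where open CommutativeSemigroupProperties ℕ.+-commutativeSemigroup using (interchange)

sum-𝟎 : ∀ n → sum (𝟎 {n}) ≡ 0
sum-𝟎 zero    = ≡.refl
sum-𝟎 (suc n) = sum-𝟎 n

≢𝟎⇒sum>0 : ∀ {n} (i : MultiIndex n) → i ≢ 𝟎 → 0 < sum i
≢𝟎⇒sum>0 []          i≢𝟎 = contradiction ≡.refl i≢𝟎
≢𝟎⇒sum>0 (zero ∷ i)  i≢𝟎 = ≢𝟎⇒sum>0 i (λ { ≡.refl → i≢𝟎 ≡.refl })
≢𝟎⇒sum>0 (suc _ ∷ _) i≢𝟎 = s≤s z≤n

⊕-≤ˡ : ∀ {n} (i j : MultiIndex n) → Pointwise _≤_ i (i ⊕ j)
⊕-≤ˡ []      []      = []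
⊕-≤ˡ (a ∷ i) (b ∷ j) = ℕ.m≤m+n a b ∷ ⊕-≤ˡ i j

⊕-≤ʳ : ∀ {n} (i j : MultiIndex n) → Pointwise _≤_ j (i ⊕ j)
⊕-≤ʳ []      []      = []
⊕-≤ʳ (a ∷ i) (b ∷ j) = ℕ.m≤n+m b a ∷ ⊕-≤ʳ i j

length≤ : ∀ {n} {Λ : List (MultiIndex n)} → All (_≢ 𝟎) Λ → length Λ ≤ sum (rowSums Λ)
length≤ []                    = z≤n
length≤ (_∷_ {c} {Λ} c≢𝟎 Λ≢𝟎) =
  ≡.subst (suc (length Λ) ≤_) (≡.sym (sum-⊕ c (rowSums Λ)))
          (ℕ.+-mono-≤ (≢𝟎⇒sum>0 c c≢𝟎) (length≤ Λ≢𝟎))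

columns≤ : ∀ {n} (Λ : List (MultiIndex n)) → All (λ c → Pointwise _≤_ c (rowSums Λ)) Λ
columns≤ []      = []
columns≤ (c ∷ Λ) = ⊕-≤ˡ c (rowSums Λ) ∷
  All.map (λ p → Pointwise.trans ℕ.≤-trans p (⊕-≤ʳ c (rowSums Λ))) (columns≤ Λ)

∈-words : ∀ {a} {X : Set a} {xs ys : List X} → All (_∈ xs) ys → ys ∈ words xs (length ys)
∈-words []       = here ≡.refl
∈-words (p ∷ ps) = ∈-cartesianProductWith⁺ _∷_ p (∈-words ps)

words-length : ∀ {a} {X : Set a} (xs : List X) l {ys} → ys ∈ words xs l → length ys ≡ l
words-length xs zero (here ≡.refl) = ≡.refl
words-length xs (suc l) ys∈
  with _ , _ , _ , b∈ , ≡.refl ← ∈-cartesianProductWith⁻ _∷_ xs (words xs l) ys∈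
  = ≡.cong suc (words-length xs l b∈)

words-disjoint : ∀ {a} {X : Set a} (xs : List X) {k l} → k ≢ l →
                 Disjoint (words xs k) (words xs l)
words-disjoint xs k≢l (p , q) =
  k≢l (≡.trans (≡.sym (words-length xs _ p)) (words-length xs _ q))

words-unique : ∀ {a} {X : Set a} {xs : List X} → Unique xs → ∀ l → Unique (words xs l)
words-unique xs! zero    = [] ∷ []
words-unique xs! (suc l) = Unique.cartesianProductWith⁺ _∷_
  (λ { ≡.refl → ≡.refl , ≡.refl }) xs! (words-unique xs! l)

∈-partitions : ∀ {n Λ} {i : MultiIndex n} → Λ ⊢ i → Λ ∈ partitions i
∈-partitions {Λ = Λ} Λ⊢i@(Λ≢𝟎 , _ , ≡.refl) = ∈-filter⁺ (_⊢? _)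
  (∈-concat⁺′ (∈-words (All.map ∈-below⁺ (columns≤ Λ)))
              (∈-map⁺ (words (below (rowSums Λ))) (∈-upTo⁺ (s≤s (length≤ Λ≢𝟎)))))
  Λ⊢i

partitions-unique : ∀ {n} (i : MultiIndex n) → Unique (partitions i)
partitions-unique i = Unique.filter⁺ (_⊢? i) (unique (Unique.upTo⁺ (suc (sum i))))
  where
  unique : ∀ {ls} → Unique ls → Unique (concatMap (words (below i)) ls)
  unique ls! = Unique.concat⁺
    (All.map⁺ (All.universal (words-unique (below-unique i)) _))
    (AllPairs.map⁺ (AllPairs.map (words-disjoint (below i)) ls!))

------------------------------------------------------------------------
-- Powers of tuples

module TuplePower {c ℓ} (S : RawSemiring c ℓ) where

  open RawSemiring S using (Carrier)
  open RawSemiringDefs S using (_^_) renaming (product to productᵗ)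

  infixr 8 _^^_

  _^^_ : ∀ {m} → Vector Carrier m → MultiIndex m → Carrier
  s ^^ k = productᵗ (λ j → s j ^ lookup k j)

------------------------------------------------------------------------
-- The ground field

-- Standing in for ℝ and ℂ, which are both of this kind (classically, with
-- the negation of equality as apartness).
record CharZeroField c ℓ₁ ℓ₂ : Set (Level.suc (c ⊔ ℓ₁ ⊔ ℓ₂)) where
  field
    heytingField : HeytingField c ℓ₁ ℓ₂

  open HeytingField heytingField public

  commutativeRing : CommutativeRing c ℓ₁
  commutativeRing = HeytingCommutativeRing.commutativeRing heytingCommutativeRing

  open CommutativeRing commutativeRing public using (semiring; rawRing)
  open Semiring semiring public using (rawSemiring)
  open RawSemiringDefs rawSemiring public using (_^_) renaming (_×_ to _·_)

  fromℕ : ℕ → Carrier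
  fromℕ n = n · 1#

  field
    charZero : ∀ n .{{_ : NonZero n}} → fromℕ n # 0#

  -- #⇒invertible inverts fromℕ n - 0#.
  1/_ : ∀ n .{{_ : NonZero n}} → Carrier
  1/ n = proj₁ (#⇒invertible (charZero n))

  ∑ ∏ : ∀ {b} {B : Set b} → List B → (B → Carrier) → Carrier
  ∑ xs f = List.foldr _+_ 0# (map f xs)
  ∏ xs f = List.foldr _*_ 1# (map f xs)

------------------------------------------------------------------------
-- Formal power series in n variables, as families of coefficients

module PowerSeries {c ℓ₁ ℓ₂} (F : CharZeroField c ℓ₁ ℓ₂) where

  open CharZeroField F hiding (zero)

  PS : ℕ → Set c
  PS n = MultiIndex n → Carrier

  infix 4 _≋_

  _≋_ : ∀ {n} → PS n → PS n → Set ℓ₁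
  f ≋ g = ∀ i → f i ≈ g i

  infixl 6 _+ᴾ_ _-ᴾ_
  infixl 7 _*ᴾ_

  _+ᴾ_ _-ᴾ_ _*ᴾ_ : ∀ {n} → PS n → PS n → PS n
  (f +ᴾ g) i = f i + g i
  (f -ᴾ g) i = f i - g i
  (f *ᴾ g) i = ∑ (below i) λ j → f j * g (i ⊖ j)

  0ᴾ 1ᴾ : ∀ {n} → PS n
  0ᴾ i = 0#
  1ᴾ i = if does (i ≟ 𝟎) then 1# else 0#

  rawSemiringᴾ : ℕ → RawSemiring c ℓ₁
  rawSemiringᴾ n = record
    { Carrier = PS n ; _≈_ = _≋_ ; _+_ = _+ᴾ_ ; _*_ = _*ᴾ_ ; 0# = 0ᴾ ; 1# = 1ᴾ }

  module _ {n : ℕ} where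
    open TuplePower (rawSemiringᴾ n) public using (_^^_)

  NoConstantTerm : ∀ {n} → PS n → Set ℓ₁
  NoConstantTerm s = s 𝟎 ≈ 0#

  -- The coefficient at i of ∑ₖ f k · s^k. Since the s j have no constant term,
  -- only the k with sum k ≤ sum i contribute (see ^^-vanishes), and all of
  -- these occur in the finite sum.
  subst : ∀ {m n} → PS m → (s : Vector (PS n) m) → (∀ j → NoConstantTerm (s j)) → PS n
  subst f s _ i = ∑ (below (replicate _ (sum i))) λ k → f k * (s ^^ k) i

  -- The exponential generating function of a family of moments.
  egf : ∀ {n} → (MultiIndex n → Carrier) → PS n
  egf m i = if does (i ≟ 𝟎) then 1# else m i * (1/ (i !ᵐ)) {{ !ᵐ-nonZero i }}

  egf-1-noConstantTerm : ∀ {n} (m : MultiIndex n → Carrier) → NoConstantTerm (egf m -ᴾ 1ᴾ)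
  egf-1-noConstantTerm {n} m rewrite dec-true (𝟎 {n} ≟ 𝟎) ≡.refl = -‿inverseʳ 1#

  VanishesBelow : ∀ {n} → ℕ → PS n → Set ℓ₁
  VanishesBelow d f = ∀ i → sum i < d → f i ≈ 0#

  open import Relation.Binary.Reasoning.Setoid setoid

  ∑-zero : ∀ {b} {B : Set b} (xs : List B) (f : B → Carrier) →
           (∀ {x} → x ∈ xs → f x ≈ 0#) → ∑ xs f ≈ 0#
  ∑-zero []       f f≈0 = refl
  ∑-zero (x ∷ xs) f f≈0 = begin
    f x + ∑ xs f  ≈⟨ +-cong (f≈0 (here ≡.refl)) (∑-zero xs f (λ p → f≈0 (there p))) ⟩
    0# + 0#       ≈⟨ +-identityˡ 0# ⟩
    0#            ∎

  ⊕-⊖ : ∀ {n} {j i : MultiIndex n} → Pointwise _≤_ j i → j ⊕ (i ⊖ j) ≡ i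
  ⊕-⊖ []       = ≡.refl
  ⊕-⊖ (p ∷ ps) = ≡.cong₂ _∷_ (ℕ.m+[n∸m]≡n p) (⊕-⊖ ps)

  *ᴾ-vanishes : ∀ {n} a b {f g : PS n} → VanishesBelow a f → VanishesBelow b g →
                VanishesBelow (a ℕ.+ b) (f *ᴾ g)
  *ᴾ-vanishes a b {f} {g} f₀ g₀ i i<a+b = ∑-zero (below i) _ λ {j} j∈ → term j (∈-below⁻ i j∈)
    where
    term : ∀ j → Pointwise _≤_ j i → f j * g (i ⊖ j) ≈ 0#
    term j j≤i with sum j ℕ.<? a
    ... | yes j<a = trans (*-congʳ (f₀ j j<a)) (zeroˡ _)
    ... | no  j≮a = trans (*-congˡ (g₀ (i ⊖ j) i⊖j<b)) (zeroʳ _)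
      where
      split : sum j ℕ.+ sum (i ⊖ j) < a ℕ.+ b
      split = ≡.subst (_< a ℕ.+ b)
        (≡.trans (≡.cong sum (≡.sym (⊕-⊖ j≤i))) (sum-⊕ j (i ⊖ j))) i<a+b
      i⊖j<b : sum (i ⊖ j) < b
      i⊖j<b = ℕ.+-cancelˡ-< a _ _
        (ℕ.≤-<-trans (ℕ.+-monoˡ-≤ (sum (i ⊖ j)) (ℕ.≮⇒≥ j≮a)) split)

  ^-vanishes : ∀ {n} (s : PS n) → NoConstantTerm s → ∀ k →
               VanishesBelow k (RawSemiringDefs._^_ (rawSemiringᴾ n) s k)
  ^-vanishes s s₀ zero    i ()
  ^-vanishes s s₀ (suc k) = *ᴾ-vanishes 1 k s-vanishes (^-vanishes s s₀ k)
    where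
    s-vanishes : VanishesBelow 1 s
    s-vanishes i i<1 with i ≟ 𝟎
    ... | yes ≡.refl = s₀
    ... | no  i≢𝟎    = contradiction i<1 (ℕ.≤⇒≯ (≢𝟎⇒sum>0 i i≢𝟎))

  ^^-vanishes : ∀ {m n} (s : Vector (PS n) m) → (∀ j → NoConstantTerm (s j)) →
                ∀ k i → sum i < sum k → (s ^^ k) i ≈ 0#
  ^^-vanishes s s₀ (k₀ ∷ k) = *ᴾ-vanishes k₀ (sum k)
    (^-vanishes (s zero) (s₀ zero) k₀)
    (^^-vanishes (λ j → s (suc j)) (λ j → s₀ (suc j)) k)

------------------------------------------------------------------------
-- Umbrae

module Umbral {c ℓ₁ ℓ₂ a} (F : CharZeroField c ℓ₁ ℓ₂) (A : Set a) where

  open CharZeroField F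
    using (_#_; 1/_; ∑; ∏; fromℕ; rawRing)
    renaming (Carrier to R; _≈_ to _≈ᴿ_; _+_ to _+ᴿ_; _*_ to _*ᴿ_; -_ to -ᴿ_;
              0# to 0ᴿ; 1# to 1ᴿ; _^_ to _^ᴿ_)
  open PowerSeries F

  infix  4 _≈_
  infixl 6 _+_
  infixl 7 _*_
  infix  8 -_

  -- R[A] as the free commutative R-algebra on the set A: terms modulo the
  -- congruence generated by the commutative ring laws and by requiring that
  -- const be a ring homomorphism. Unlike coefficient families, this does not
  -- need equality on A to be decidable.
  data R[A] : Set (c ⊔ a) where
    const   : R → R[A]
    var     : A → R[A]
    _+_ _*_ : R[A] → R[A] → R[A]
    -_      : R[A] → R[A]

  data _≈_ : R[A] → R[A] → Set (c ⊔ ℓ₁ ⊔ a) where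
    refl        : ∀ {p} → p ≈ p
    sym         : ∀ {p q} → p ≈ q → q ≈ p
    trans       : ∀ {p q r} → p ≈ q → q ≈ r → p ≈ r
    +-cong      : ∀ {p p′ q q′} → p ≈ p′ → q ≈ q′ → p + q ≈ p′ + q′
    *-cong      : ∀ {p p′ q q′} → p ≈ p′ → q ≈ q′ → p * q ≈ p′ * q′
    -‿cong      : ∀ {p p′} → p ≈ p′ → - p ≈ - p′
    +-assoc     : ∀ p q r → (p + q) + r ≈ p + (q + r)
    +-comm      : ∀ p q → p + q ≈ q + p
    +-identityˡ : ∀ p → const 0ᴿ + p ≈ p
    -‿inverseˡ  : ∀ p → - p + p ≈ const 0ᴿ
    *-assoc     : ∀ p q r → (p * q) * r ≈ p * (q * r)
    *-comm      : ∀ p q → p * q ≈ q * p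
    *-identityˡ : ∀ p → const 1ᴿ * p ≈ p
    distribˡ    : ∀ p q r → p * (q + r) ≈ p * q + p * r
    const-cong  : ∀ {x y} → x ≈ᴿ y → const x ≈ const y
    const-+     : ∀ x y → const (x +ᴿ y) ≈ const x + const y
    const-*     : ∀ x y → const (x *ᴿ y) ≈ const x * const y

  commutativeRing : CommutativeRing _ _
  commutativeRing = record
    { Carrier = R[A] ; _≈_ = _≈_ ; _+_ = _+_ ; _*_ = _*_ ; -_ = -_
    ; 0# = const 0ᴿ ; 1# = const 1ᴿ
    ; isCommutativeRing = record
      { isRing = record
        { +-isAbelianGroup = record
          { isGroup = record
            { isMonoid = record
              { isSemigroup = record
                { isMagma = record
                  { isEquivalence = record { refl = refl ; sym = sym ; trans = trans }
                  ; ∙-cong = +-cong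
                  }
                ; assoc = +-assoc
                }
              ; identity = +-identityˡ , λ p → trans (+-comm p _) (+-identityˡ p)
              }
            ; inverse = -‿inverseˡ , λ p → trans (+-comm p _) (-‿inverseˡ p)
            ; ⁻¹-cong = -‿cong
            }
          ; comm = +-comm
          }
        ; *-cong = *-cong
        ; *-assoc = *-assoc
        ; *-identity = *-identityˡ , λ p → trans (*-comm p _) (*-identityˡ p)
        ; distrib = distribˡ , λ p q r → trans (*-comm _ p)
            (trans (distribˡ p q r) (+-cong (*-comm p q) (*-comm p r)))
        }
      ; *-comm = *-comm
      }
    }

  open CommutativeRing commutativeRing using (semiring)
  open Semiring semiring using (rawSemiring)
  open RawSemiringDefs rawSemiring public using (_^_) renaming (sum to sumᵗ)
  open TuplePower rawSemiring public using () renaming (_^^_ to _^^ᵗ_)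

  rawLeftModule : RawLeftModule R _ _
  rawLeftModule = record
    { Carrierᴹ = R[A] ; _≈ᴹ_ = _≈_ ; _+ᴹ_ = _+_ ; _*ₗ_ = λ x p → const x * p
    ; 0ᴹ = const 0ᴿ ; -ᴹ_ = -_ }

  -- α^i γ^j ⋯ for a list (α , i) ∷ (γ , j) ∷ ⋯
  powerProduct : List (A × ℕ) → R[A]
  powerProduct = List.foldr (λ (α , i) p → var α ^ i * p) (const 1ᴿ)

  IsMonomial : R[A] → Set _
  IsMonomial p = ∃[ x ] (x # 0ᴿ) × (∃[ αs ] p ≈ const x * powerProduct αs)

  open LeftModuleMorphisms rawLeftModule (TensorUnit.rawLeftModule {R = rawRing})
    using (IsLeftModuleHomomorphism)

  record IsEvaluation (E : R[A] → R) : Set (c ⊔ ℓ₁ ⊔ a) where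
    field
      isLinear       : IsLeftModuleHomomorphism E
      unital         : E (const 1ᴿ) ≈ᴿ 1ᴿ
      uncorrelated   : ∀ αs → Unique (map proj₁ αs) →
                       E (powerProduct αs) ≈ᴿ ∏ αs λ (α , i) → E (var α ^ i)

  module Evaluation (E : R[A] → R) where

    moment : ∀ {n} → Vector R[A] n → MultiIndex n → R
    moment μ i = E (μ ^^ᵗ i)

    h : ∀ {n} → Vector R[A] n → List (MultiIndex n) → R
    h ν Λ = ∏ (distinct Λ) λ c → moment ν c ^ᴿ mult c Λ

    -- The auxiliary umbra p.β.ν is a symbol determined by its moments, and is
    -- identified with the family of these.
    _∙β∙_ : ∀ {n} → R[A] → Vector R[A] n → MultiIndex n → R
    (p ∙β∙ ν) i = ∑ (partitions i) λ Λ →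
      fromℕ (i !ᵐ) *ᴿ (1/ (𝔪[ Λ ]! ℕ.* Λ !ᵖ)) {{ 𝔪!*!ᵖ-nonZero Λ }}
        *ᴿ E (p ^ length Λ) *ᴿ h ν Λ

{-# OPTIONS --safe #-}
-- Both series are expanded by the multinomial theorem. With p = μ₁ + ⋯ + μₙ
-- and s = f(ν,t) − 1, E[pˡ]/l! is the sum of E[μᵏ]/k! over |k| = l, so the
-- substitution equals ∑ₗ E[pˡ] sˡ/l!. Up to degree i, s is the finite sum of the
-- monomials s_c t^c over the nonzero c ≤ i; the multinomial theorem for that sum
-- writes sˡ/l! as a sum over the multiplicities κ with |κ| = l. Listing each
-- column c, in lexicographic order, κ_c times identifies the κ contributing to
-- t^i with the partitions Λ ⊢ i, where κ! = 𝔪(Λ)! and |κ| = l(Λ).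

module Submission where

open import Defs
open import Algebra.Bundles using (CommutativeMonoid; CommutativeSemiring; CommutativeRing)
import Algebra.Definitions.RawMonoid as RawMonoidDefs
import Algebra.Definitions.RawSemiring as RawSemiringDefs
open import Algebra.Module.Morphism.Structures using (module IsLeftModuleHomomorphism)
import Algebra.Properties.CommutativeMonoid.Mult as CommutativeMonoidMult
import Algebra.Properties.CommutativeSemigroup as CommutativeSemigroupProperties
import Algebra.Properties.CommutativeSemiring.Binomial as Binomial
import Algebra.Properties.CommutativeSemiring.Exp as CommutativeSemiringExp
import Algebra.Properties.Group as GroupProperties
import Algebra.Properties.Semiring.Exp as SemiringExp
import Algebra.Properties.Semiring.Mult as SemiringMult
open import Algebra.Structures.Biased using (isCommutativeSemiringˡ)
open import Data.Bool.Base using (if_then_else_)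
open import Data.Fin.Base using (zero; suc; toℕ)
open import Data.List.Base as List
  using (List; []; _∷_; _++_; map; filter; length; lookup; deduplicate; upTo; applyUpTo;
         concatMap; cartesianProductWith)
import Data.List.Membership.DecPropositional as DecMembership
open import Data.List.Membership.Propositional using (_∈_; _∉_)
open import Data.List.Membership.Propositional.Properties
  using (∈-++⁻; ∈-deduplicate⁺; ∈-deduplicate⁻; ∈-filter⁺; ∈-filter⁻; ∈-map⁺; ∈-map⁻;
         ∈-upTo⁺; ∈-upTo⁻)
import Data.List.Properties as List
open import Data.List.Relation.Binary.Permutation.Propositional using (↭-sym; ↭⇒↭ₛ)
open import Data.List.Relation.Binary.Permutation.Propositional.Properties using (∈-resp-↭)
open import Data.List.Relation.Binary.Permutation.Setoid.Properties using (Unique-resp-↭)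
open import Data.List.Relation.Unary.All as All using (All; []; _∷_)
import Data.List.Relation.Unary.All.Properties as All
open import Data.List.Relation.Unary.AllPairs using (AllPairs; []; _∷_)
import Data.List.Relation.Unary.AllPairs.Properties as AllPairs
open import Data.List.Relation.Unary.Any using (here; there)
open import Data.List.Relation.Unary.Sorted.TotalOrder.Properties
  using (AllPairs⇒Sorted; Sorted⇒AllPairs)
import Data.List.Relation.Unary.Unique.DecPropositional.Properties as DecUnique
open import Data.List.Relation.Unary.Unique.Propositional using (Unique)
import Data.List.Relation.Unary.Unique.Propositional.Properties as Unique
import Data.List.Sort as Sort
open import Data.Nat.Base as ℕ using (ℕ; zero; suc; _≤_; _<_; _∸_; _!; NonZero; s≤s)
open import Data.Nat.Combinatorics
  using (nCk≡n!/k![n-k]!; k![n∸k]!∣n!) renaming (_C_ to _choose_)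
open import Data.Nat.DivMod using (m/n*n≡m)
import Data.Nat.Properties as ℕ
open import Data.Product.Base as Product using (∃; _,_; proj₂)
open import Data.Sum.Base using (inj₁; inj₂)
open import Data.Vec.Base using ([]; _∷_; replicate) renaming (sum to ∣_∣; lookup to lookupᵐ)
open import Data.Vec.Functional using (Vector)
open import Data.Vec.Properties using (zipWith-assoc; zipWith-comm; zipWith-identityˡ)
open import Data.Vec.Relation.Binary.Pointwise.Inductive as Pointwise
  using (Pointwise; []; _∷_)
open import Function.Base using (_∘_; id)
open import Level using (_⊔_)
open import Relation.Binary.Bundles using (DecTotalOrder)
open import Relation.Binary.Definitions using (DecidableEquality; Reflexive; Antisymmetric)
open import Relation.Binary.PropositionalEquality as ≡ using (_≡_; _≢_)
open import Relation.Binary.Structures using (IsEquivalence)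
open import Relation.Nullary.Decidable using (Dec; yes; no; does; ¬?)
open import Relation.Nullary.Negation using (¬_; contradiction)

-- Finite sums and products over lists

-- Everything is proved one coefficient at a time. With the target index i fixed, series are
-- compared only at indices ≤ i; up to this equality s is a finite sum of monomials, and one
-- multinomial theorem, stated for any commutative semiring, serves R[A] and the series alike. Two
-- obstacles shape its use. E is linear but need not respect products, and neither does taking the
-- coefficient at i; so each passes through sums only, never through powers. And a general
-- commutative semiring has no inverses of natural numbers, so the theorem is stated with natural
-- multiples, and factorials are divided out only after such an additive map into the field has been
-- applied. Index sets are fixed boxes, and conditions such as |k| = l become guards on the
-- summands, so that sums can be exchanged freely.

module BigOperator {c ℓ} (M : CommutativeMonoid c ℓ) where

  open CommutativeMonoid M
  open import Relation.Binary.Reasoning.Setoid setoid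
  open CommutativeSemigroupProperties commutativeSemigroup using (interchange)

  infix 9 [_]_

  -- The Iverson bracket: it restricts a sum over a fixed list to the indices with a property, with
  -- the neutral element as filler.
  [_]_ : ∀ {p} {P : Set p} → Dec P → Carrier → Carrier
  [ d ] x = if does d then x else ε

  []-yes : ∀ {p} {P : Set p} (d : Dec P) {x} → P → [ d ] x ≈ x
  []-yes (yes _) _  = refl
  []-yes (no ¬p) p = contradiction p ¬p

  []-no : ∀ {p} {P : Set p} (d : Dec P) {x} → ¬ P → [ d ] x ≈ ε
  []-no (yes p) ¬p = contradiction p ¬p
  []-no (no _)  _  = refl

  []-cong : ∀ {p q} {P : Set p} {Q : Set q} (d : Dec P) (e : Dec Q) {x y} →
            (P → Q) → (Q → P) → (P → x ≈ y) → [ d ] x ≈ [ e ] y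
  []-cong (yes p) e p⇒q q⇒p x≈y = trans (x≈y p) (sym ([]-yes e (p⇒q p)))
  []-cong (no ¬p) e p⇒q q⇒p x≈y = sym ([]-no e (¬p ∘ q⇒p))

  -- Unfolds to `∑` for the additive and to `∏` for the multiplicative monoid of the field.
  big : ∀ {b} {B : Set b} → List B → (B → Carrier) → Carrier
  big xs f = List.foldr _∙_ ε (map f xs)

  module _ {b} {B : Set b} where

    big-cong : ∀ (xs : List B) {f g} → (∀ {x} → x ∈ xs → f x ≈ g x) → big xs f ≈ big xs g
    big-cong []       f≈g = refl
    big-cong (x ∷ xs) f≈g = ∙-cong (f≈g (here ≡.refl)) (big-cong xs (f≈g ∘ there))

    big-ε : ∀ (xs : List B) {f} → (∀ {x} → x ∈ xs → f x ≈ ε) → big xs f ≈ ε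
    big-ε []       f≈ε = refl
    big-ε (x ∷ xs) f≈ε = trans (∙-cong (f≈ε (here ≡.refl)) (big-ε xs (f≈ε ∘ there))) (identityˡ ε)

    big-∙ : ∀ (xs : List B) f g → big xs (λ x → f x ∙ g x) ≈ big xs f ∙ big xs g
    big-∙ []       f g = sym (identityˡ ε)
    big-∙ (x ∷ xs) f g = trans (∙-congˡ (big-∙ xs f g)) (interchange _ _ _ _)

    big-++ : ∀ (xs ys : List B) f → big (xs ++ ys) f ≈ big xs f ∙ big ys f
    big-++ []       ys f = sym (identityˡ _)
    big-++ (x ∷ xs) ys f = trans (∙-congˡ (big-++ xs ys f)) (sym (assoc _ _ _))

    big-single : ∀ {xs : List B} {x} f → Unique xs → x ∈ xs →
                 (∀ {y} → y ∈ xs → y ≢ x → f y ≈ ε) → big xs f ≈ f x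
    big-single {_ ∷ xs} f (x∉ ∷ _) (here ≡.refl) f≈ε =
      trans (∙-congˡ (big-ε xs λ y∈ → f≈ε (there y∈) λ { ≡.refl → All.lookup x∉ y∈ ≡.refl }))
            (identityʳ _)
    big-single f (y∉ ∷ xs!) (there x∈) f≈ε =
      trans (∙-cong (f≈ε (here ≡.refl) λ { ≡.refl → All.lookup y∉ x∈ ≡.refl })
                    (big-single f xs! x∈ (f≈ε ∘ there)))
            (identityˡ _)

  module _ {b d} {B : Set b} {D : Set d} where

    big-swap : ∀ (xs : List B) (ys : List D) (f : B → D → Carrier) →
               big xs (λ x → big ys (f x)) ≈ big ys (λ y → big xs (λ x → f x y))
    big-swap []       ys f = sym (big-ε ys λ _ → refl)
    big-swap (x ∷ xs) ys f = trans (∙-congˡ (big-swap xs ys f)) (sym (big-∙ ys _ _))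

    big-map : ∀ (g : B → D) xs f → big (map g xs) f ≈ big xs (f ∘ g)
    big-map g []       f = refl
    big-map g (x ∷ xs) f = ∙-congˡ (big-map g xs f)

  big-cartesianProductWith : ∀ {b d e} {B : Set b} {D : Set d} {E : Set e} (g : B → D → E) xs ys f →
    big (cartesianProductWith g xs ys) f ≈ big xs (λ x → big ys (λ y → f (g x y)))
  big-cartesianProductWith g []       ys f = refl
  big-cartesianProductWith g (x ∷ xs) ys f =
    trans (big-++ (map (g x) ys) _ f)
          (∙-cong (big-map (g x) ys f) (big-cartesianProductWith g xs ys f))

  -- Both sums are the total of one matrix, with f on the diagonal and ε elsewhere, taken by rows
  -- and by columns. The lists need not be permutations of each other: an element of only one list
  -- contributes ε.
  big-support : ∀ {b} {B : Set b} → DecidableEquality B → ∀ {xs ys : List B} f →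
                Unique xs → Unique ys →
                (∀ {x} → x ∈ xs → x ∉ ys → f x ≈ ε) →
                (∀ {y} → y ∈ ys → y ∉ xs → f y ≈ ε) →
                big xs f ≈ big ys f
  big-support _≟ᴮ_ {xs} {ys} f xs! ys! xs∖ys ys∖xs = begin
    big xs f                      ≈⟨ big-cong xs (λ {x} x∈ → expandʳ x∈) ⟩
    big xs (λ x → big ys (δ x))   ≈⟨ big-swap xs ys δ ⟩
    big ys (λ y → big xs (λ x → δ x y)) ≈⟨ big-cong ys (λ {y} y∈ → expandˡ y∈) ⟨
    big ys f                      ∎
    where
    open DecMembership _≟ᴮ_ using (_∈?_)
    δ : _ → _ → Carrier
    δ x y = [ x ≟ᴮ y ] f x
    expandʳ : ∀ {x} → x ∈ xs → f x ≈ big ys (δ x)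
    expandʳ {x} x∈ with x ∈? ys
    ... | yes x∈ys = sym (trans
      (big-single (δ x) ys! x∈ys λ _ y≢x → []-no (x ≟ᴮ _) (y≢x ∘ ≡.sym)) ([]-yes (x ≟ᴮ x) ≡.refl))
    ... | no  x∉ys = trans (xs∖ys x∈ x∉ys)
      (sym (big-ε ys λ {y} y∈ → []-no (x ≟ᴮ y) λ { ≡.refl → x∉ys y∈ }))
    expandˡ : ∀ {y} → y ∈ ys → f y ≈ big xs (λ x → δ x y)
    expandˡ {y} y∈ with y ∈? xs
    ... | yes y∈xs = sym (trans
      (big-single (λ x → δ x y) xs! y∈xs λ _ x≢y → []-no (_ ≟ᴮ y) x≢y) ([]-yes (y ≟ᴮ y) ≡.refl))
    ... | no  y∉xs = trans (ys∖xs y∈ y∉xs)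
      (sym (big-ε xs λ {x} x∈ → []-no (x ≟ᴮ y) λ { ≡.refl → y∉xs x∈ }))

module _ {c₁ ℓ₁ c₂ ℓ₂} (M : CommutativeMonoid c₁ ℓ₁) (N : CommutativeMonoid c₂ ℓ₂) where

  private
    module M = CommutativeMonoid M
    module N = CommutativeMonoid N
    open BigOperator

  -- Only the monoid operation is preserved; this is how E, the coefficient at i and multiplication
  -- by a fixed factor pass through sums.
  big-homo : (φ : M.Carrier → N.Carrier) → φ M.ε N.≈ N.ε →
             (∀ x y → φ (x M.∙ y) N.≈ φ x N.∙ φ y) →
             ∀ {b} {B : Set b} (xs : List B) f → φ (big M xs f) N.≈ big N xs (φ ∘ f)
  big-homo φ φ-ε φ-∙ []       f = φ-ε
  big-homo φ φ-ε φ-∙ (x ∷ xs) f = N.trans (φ-∙ _ _) (N.∙-congˡ (big-homo φ φ-ε φ-∙ xs f))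

-- The multinomial theorem

-- The coefficient |k|!/k! as a product of binomial coefficients, the form in which it arises when
-- the binomial theorem splits off one variable at a time.
multinomial : ∀ {N} → MultiIndex N → ℕ
multinomial []      = 1
multinomial (a ∷ k) = ((a ℕ.+ ∣ k ∣) choose a) ℕ.* multinomial k

nCk*k!*[n∸k]!≡n! : ∀ {n k} → k ≤ n → (n choose k) ℕ.* (k ! ℕ.* (n ∸ k) !) ≡ n !
nCk*k!*[n∸k]!≡n! {n} {k} k≤n = ≡.trans
  (≡.cong (ℕ._* (k ! ℕ.* (n ∸ k) !)) (nCk≡n!/k![n-k]! k≤n))
  (m/n*n≡m {{ k ℕ.!* (n ∸ k) !≢0 }} (k![n∸k]!∣n! k≤n))

multinomial*!≡sum! : ∀ {N} (k : MultiIndex N) → multinomial k ℕ.* k !ᵐ ≡ ∣ k ∣ !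
multinomial*!≡sum! []      = ≡.refl
multinomial*!≡sum! (a ∷ k) = begin
  b ℕ.* m ℕ.* (a ! ℕ.* k !ᵐ)          ≡⟨ interchange b m (a !) (k !ᵐ) ⟩
  b ℕ.* a ! ℕ.* (m ℕ.* k !ᵐ)          ≡⟨ ≡.cong (b ℕ.* a ! ℕ.*_) (multinomial*!≡sum! k) ⟩
  b ℕ.* a ! ℕ.* s !                   ≡⟨ ℕ.*-assoc b (a !) (s !) ⟩
  b ℕ.* (a ! ℕ.* s !)                 ≡⟨ ≡.cong (λ t → b ℕ.* (a ! ℕ.* t !)) (ℕ.m+n∸m≡n a s) ⟨
  b ℕ.* (a ! ℕ.* (a ℕ.+ s ∸ a) !)     ≡⟨ nCk*k!*[n∸k]!≡n! (ℕ.m≤m+n a s) ⟩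
  (a ℕ.+ s) !                         ∎
  where
  s = ∣ k ∣
  b = (a ℕ.+ s) choose a
  m = multinomial k
  open ≡.≡-Reasoning
  open CommutativeSemigroupProperties ℕ.*-commutativeSemigroup using (interchange)

module MultinomialTheorem {c ℓ} (K : CommutativeSemiring c ℓ) where

  open CommutativeSemiring K hiding (zero)
  open RawSemiringDefs rawSemiring using (_^_; _×_; sum)
  open SemiringMult semiring using (×-congʳ; ×-comm-*; ×-assocˡ)
  open TuplePower rawSemiring using (_^^_)
  open BigOperator +-commutativeMonoid
  open CommutativeMonoidMult +-commutativeMonoid using (×-distrib-+)
  open import Relation.Binary.Reasoning.Setoid setoid

  ×-zeroʳ : ∀ n → n × 0# ≈ 0#
  ×-zeroʳ zero    = refl
  ×-zeroʳ (suc n) = trans (+-identityˡ _) (×-zeroʳ n)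

  sum-applyUpTo : ∀ n (f : ℕ → Carrier) (g : ℕ → ℕ) → sum {n} (f ∘ g ∘ toℕ) ≈ big (applyUpTo g n) f
  sum-applyUpTo zero    f g = refl
  sum-applyUpTo (suc n) f g = +-congˡ (sum-applyUpTo n f (g ∘ suc))

  ×-*-big : ∀ m x {b p} {B : Set b} {P : B → Set p} (P? : ∀ k → Dec (P k)) ks
             (n : B → ℕ) (f : B → Carrier) →
              m × (x * big ks (λ k → [ P? k ] (n k × f k))) ≈
              big ks (λ k → [ P? k ] ((m ℕ.* n k) × (x * f k)))
  ×-*-big m x P? ks n f = trans
    (big-homo +-commutativeMonoid +-commutativeMonoid (λ y → m × (x * y))
      (trans (×-congʳ m (zeroʳ x)) (×-zeroʳ m))
      (λ y z → trans (×-congʳ m (distribˡ x y z)) (×-distrib-+ (x * y) (x * z) m)) ks _)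
    (big-cong ks λ {k} _ → term k)
    where
    term : ∀ k → m × (x * [ P? k ] (n k × f k)) ≈ [ P? k ] ((m ℕ.* n k) × (x * f k))
    term k with P? k
    ... | yes _ = trans (×-congʳ m (×-comm-* (n k) x (f k))) (×-assocˡ _ m (n k))
    ... | no  _ = trans (×-congʳ m (zeroʳ x)) (×-zeroʳ m)

  -- The box of side L contains every k with |k| = l; leaving L free lets one box
  -- serve all exponents l ≤ L at once.
  multinomialTheorem : ∀ {N} (x : Vector Carrier N) {l L} → l ≤ L →
    sum x ^ l ≈ big (below (replicate N L)) (λ k → [ ∣ k ∣ ℕ.≟ l ] (multinomial k × (x ^^ k)))
  multinomialTheorem {zero}  x {zero}  _ = sym (trans (+-identityʳ _) (+-identityʳ _))
  multinomialTheorem {zero}  x {suc l} _ = trans (zeroˡ _) (sym (+-identityʳ _))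
  multinomialTheorem {suc N} x {l} {L} l≤L = begin
    (x zero + S) ^ l
      ≈⟨ Binomial.theorem K l (x zero) S ⟩
    sum {suc l} (λ a → (l choose toℕ a) × (x zero ^ toℕ a * S ^ (l ∸ toℕ a)))
      ≈⟨ sum-applyUpTo (suc l) (λ a → (l choose a) × (x zero ^ a * S ^ (l ∸ a))) (λ a → a) ⟩
    big (upTo (suc l)) (λ a → (l choose a) × (x zero ^ a * S ^ (l ∸ a)))
      ≈⟨ big-cong (upTo (suc l)) (λ {a} a∈ → low a (ℕ.s≤s⁻¹ (∈-upTo⁻ a∈))) ⟩
    big (upTo (suc l)) (λ a → big ks (λ k → term (a ∷ k)))
      -- The range a ≤ l grows to a ≤ L; the new summands are zero because a + |k| = l forces a ≤ l.
      ≈⟨ big-support ℕ._≟_ _ (Unique.upTo⁺ (suc l)) (Unique.upTo⁺ (suc L))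
           (λ a∈ a∉ → contradiction (∈-upTo⁺ (ℕ.<-≤-trans (∈-upTo⁻ a∈) (s≤s l≤L))) a∉)
           (λ {a} _ a∉ → big-ε ks λ {k} _ → []-no (a ℕ.+ ∣ k ∣ ℕ.≟ l) λ { ≡.refl →
              a∉ (∈-upTo⁺ (s≤s (ℕ.m≤m+n a ∣ k ∣))) }) ⟩
    big (upTo (suc L)) (λ a → big ks (λ k → term (a ∷ k)))
      ≈⟨ big-cartesianProductWith _∷_ (upTo (suc L)) ks term ⟨
    big (below (replicate (suc N) L)) term ∎
    where
    S = sum (x ∘ suc)
    ks = below (replicate N L)
    term : MultiIndex (suc N) → Carrier
    term k = [ ∣ k ∣ ℕ.≟ l ] (multinomial k × (x ^^ k))
    low : ∀ a → a ≤ l → (l choose a) × (x zero ^ a * S ^ (l ∸ a)) ≈ big ks (λ k → term (a ∷ k))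
    low a a≤l = begin
      (l choose a) × (x zero ^ a * S ^ (l ∸ a))
        ≈⟨ ×-congʳ (l choose a) (*-congˡ (multinomialTheorem (x ∘ suc)
             (ℕ.≤-trans (ℕ.m∸n≤m l a) l≤L))) ⟩
      (l choose a) × (x zero ^ a *
          big ks (λ k → [ ∣ k ∣ ℕ.≟ l ∸ a ] (multinomial k × ((x ∘ suc) ^^ k))))
        ≈⟨ ×-*-big (l choose a) (x zero ^ a) (λ k → ∣ k ∣ ℕ.≟ l ∸ a) ks multinomial ((x ∘ suc) ^^_) ⟩
      big ks (λ k → [ ∣ k ∣ ℕ.≟ l ∸ a ]
          (((l choose a) ℕ.* multinomial k) × (x zero ^ a * (x ∘ suc) ^^ k)))
        -- Under the guard l = a + |k|, so `l choose a` is the leading factor of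
        -- `multinomial (a ∷ k)`.
        ≈⟨ big-cong ks (λ {k} _ → []-cong (∣ k ∣ ℕ.≟ l ∸ a) (a ℕ.+ ∣ k ∣ ℕ.≟ l)
             (λ e → ≡.trans (≡.cong (a ℕ.+_) e) (ℕ.m+[n∸m]≡n a≤l))
             (λ { ≡.refl → ≡.sym (ℕ.m+n∸m≡n a ∣ k ∣) })
             λ e → reflexive (≡.cong
               (λ t → ((t choose a) ℕ.* multinomial k) × (x zero ^ a * (x ∘ suc) ^^ k))
               (≡.sym (≡.trans (≡.cong (a ℕ.+_) e) (ℕ.m+[n∸m]≡n a≤l))))) ⟩
      big ks (λ k → term (a ∷ k)) ∎

-- Lists and multiplicities

-- A list with entries from C is encoded, up to reordering, by the
-- multiplicities of the members of C.
expand : ∀ {x} {X : Set x} (C : List X) → MultiIndex (length C) → List X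
expand []      []      = []
expand (c ∷ C) (k ∷ κ) = List.replicate k c ++ expand C κ

module _ {x} {X : Set x} where

  ∈-replicate⁻ : ∀ k {c d : X} → d ∈ List.replicate k c → d ≡ c
  ∈-replicate⁻ (suc k) (here d≡c) = d≡c
  ∈-replicate⁻ (suc k) (there d∈) = ∈-replicate⁻ k d∈

  ∈-expand⁻ : ∀ (C : List X) κ {d} → d ∈ expand C κ → d ∈ C
  ∈-expand⁻ []      []      ()
  ∈-expand⁻ (c ∷ C) (k ∷ κ) d∈ with ∈-++⁻ (List.replicate k c) d∈
  ... | inj₁ d∈ˡ = here (∈-replicate⁻ k d∈ˡ)
  ... | inj₂ d∈ʳ = there (∈-expand⁻ C κ d∈ʳ)

  length-expand : ∀ (C : List X) κ → length (expand C κ) ≡ ∣ κ ∣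
  length-expand []      []      = ≡.refl
  length-expand (c ∷ C) (k ∷ κ) = ≡.trans (List.length-++ (List.replicate k c))
    (≡.cong₂ ℕ._+_ (List.length-replicate k) (length-expand C κ))

  module _ {r} {_≤_ : X → X → Set r} (≤-refl : Reflexive _≤_) where

    AllPairs-replicate : ∀ k {c} → AllPairs _≤_ (List.replicate k c)
    AllPairs-replicate zero    = []
    AllPairs-replicate (suc k) = All.replicate⁺ k ≤-refl ∷ AllPairs-replicate k

    expand-sorted : ∀ {C} κ → AllPairs _≤_ C → AllPairs _≤_ (expand C κ)
    expand-sorted             []      []         = []
    expand-sorted {C = c ∷ C} (k ∷ κ) (c≤ ∷ C↗) =
      AllPairs.++⁺ (AllPairs-replicate k) (expand-sorted κ C↗)
      (All.replicate⁺ k (All.tabulate (All.lookup c≤ ∘ ∈-expand⁻ C κ)))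

  expand-complete : ∀ {r} {_≤_ : X → X → Set r} → Antisymmetric _≡_ _≤_ →
                    ∀ {C Λ} → AllPairs _≤_ C → AllPairs _≤_ Λ → Unique C → All (_∈ C) Λ →
                    ∃ λ κ → Λ ≡ expand C κ
  expand-complete antisym {[]}    {[]} _ _ _ _ = [] , ≡.refl
  expand-complete antisym {[]}    {_ ∷ _} _ _ _ (() ∷ _)
  expand-complete antisym {c ∷ C} {[]} (_ ∷ C↗) _ (_ ∷ C!) _
    with κ , eq ← expand-complete antisym C↗ [] C! [] = 0 ∷ κ , eq
  expand-complete antisym {c ∷ C} {_ ∷ Λ} C↗ (_ ∷ Λ↗) C! (here ≡.refl ∷ Λ∈)
    with k ∷ κ , eq ← expand-complete antisym C↗ Λ↗ C! Λ∈ = suc k ∷ κ , ≡.cong (c ∷_) eq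
  expand-complete antisym {c ∷ C} {d ∷ Λ} (c≤ ∷ C↗) (d≤ ∷ Λ↗) (c∉ ∷ C!) (there d∈ ∷ Λ∈)
    = Product.map (0 ∷_) id (expand-complete antisym C↗ (d≤ ∷ Λ↗) C! (d∈ ∷ All.tabulate tail))
    where
    tail : ∀ {e} → e ∈ Λ → e ∈ C
    tail e∈ with All.lookup Λ∈ e∈
    ... | there e∈C    = e∈C
    ... | here ≡.refl =
      contradiction (antisym (All.lookup c≤ d∈) (All.lookup d≤ e∈)) (All.lookup c∉ d∈)

module Multiplicity {x} {X : Set x} (_≟ˣ_ : DecidableEquality X) where

  -- At `_≟_` on multi-indices this is `mult`.
  count : X → List X → ℕ
  count c xs = length (filter (c ≟ˣ_) xs)

  count-∉ : ∀ {c xs} → c ∉ xs → count c xs ≡ 0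
  count-∉ {c} c∉ = ≡.cong length (List.filter-none (c ≟ˣ_) (All.tabulate λ { x∈ ≡.refl → c∉ x∈ }))

  count-replicate : ∀ k c xs → count c (List.replicate k c ++ xs) ≡ k ℕ.+ count c xs
  count-replicate zero    c xs = ≡.refl
  count-replicate (suc k) c xs =
    ≡.trans (≡.cong length (List.filter-accept (c ≟ˣ_) ≡.refl))
            (≡.cong suc (count-replicate k c xs))

  count-replicate-≢ : ∀ k {c d} xs → c ≢ d → count c (List.replicate k d ++ xs) ≡ count c xs
  count-replicate-≢ zero    xs c≢d = ≡.refl
  count-replicate-≢ (suc k) xs c≢d =
    ≡.trans (≡.cong length (List.filter-reject (_ ≟ˣ_) c≢d)) (count-replicate-≢ k xs c≢d)

  count-expand-head : ∀ {c C} k κ → All (c ≢_) C → count c (expand (c ∷ C) (k ∷ κ)) ≡ k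
  count-expand-head {c} {C} k κ c∉ = ≡.trans (count-replicate k c (expand C κ))
    (≡.trans (≡.cong (k ℕ.+_) (count-∉ λ c∈ → All.lookup c∉ (∈-expand⁻ C κ c∈) ≡.refl))
             (ℕ.+-identityʳ k))

  -- The multiplicity of the head can be recovered by counting, since it does not recur in the rest
  -- of C.
  expand-injective : ∀ {C : List X} → Unique C → ∀ κ κ′ → expand C κ ≡ expand C κ′ → κ ≡ κ′
  expand-injective []              []      []        eq = ≡.refl
  expand-injective {c ∷ C} (c∉ ∷ C!) (k ∷ κ) (k′ ∷ κ′) eq
    with ≡.refl ← ≡.trans (≡.sym (count-expand-head k κ c∉))
                    (≡.trans (≡.cong (count c) eq) (count-expand-head k′ κ′ c∉))
    = ≡.cong (k ∷_) (expand-injective C! κ κ′ (List.++-cancelˡ (List.replicate k c) _ _ eq))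

  module _ {c ℓ} (M : CommutativeMonoid c ℓ) where

    open CommutativeMonoid M
    open BigOperator M
    open RawMonoidDefs rawMonoid using (sum)

    -- The distinct entries of the expansion are the members of C with positive multiplicity, and
    -- the others contribute φ c 0 ≈ ε. One statement covers 𝔪(Λ)!, Λ! and h_Λ, with φ c k equal to
    -- k!, (c!)^k and h_c^k.
    big-deduplicate : ∀ (φ : X → ℕ → Carrier) → (∀ c → φ c 0 ≈ ε) →
                      ∀ {C} → Unique C → ∀ κ →
                      big (deduplicate _≟ˣ_ (expand C κ)) (λ c → φ c (count c (expand C κ))) ≈
                      sum (λ j → φ (lookup C j) (lookupᵐ κ j))
    big-deduplicate φ φ-0 {C} C! κ = trans
      (big-support _≟ˣ_ _ (DecUnique.deduplicate-! _≟ˣ_ _) C!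
        (λ d∈ d∉ → contradiction (∈-expand⁻ C κ (∈-deduplicate⁻ _≟ˣ_ (expand C κ) d∈)) d∉)
        (λ {d} _ d∉ → trans (reflexive (≡.cong (φ d) (count-∉ (d∉ ∘ ∈-deduplicate⁺ _≟ˣ_)))) (φ-0 d)))
      (big-count C! κ)
      where
      big-count : ∀ {C} → Unique C → ∀ κ →
                  big C (λ c → φ c (count c (expand C κ))) ≈
                  sum (λ j → φ (lookup C j) (lookupᵐ κ j))
      big-count {[]}    []        []      = refl
      big-count {c ∷ C} (c∉ ∷ C!) (k ∷ κ) = ∙-cong
        (reflexive (≡.cong (φ c) (count-expand-head k κ c∉)))
        (trans (big-cong C λ {d} d∈ → reflexive (≡.cong (φ d)
                 (count-replicate-≢ k (expand C κ) λ { ≡.refl → All.lookup c∉ d∈ ≡.refl })))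
               (big-count C! κ))

-- Truncated power series

⊖-≤ : ∀ {n} (i j : MultiIndex n) → Pointwise _≤_ (i ⊖ j) i
⊖-≤ []      []      = []
⊖-≤ (a ∷ i) (b ∷ j) = ℕ.m∸n≤m a b ∷ ⊖-≤ i j

⊕-⊖-cancelˡ : ∀ {n} (c d : MultiIndex n) → (c ⊕ d) ⊖ c ≡ d
⊕-⊖-cancelˡ []      []      = ≡.refl
⊕-⊖-cancelˡ (a ∷ c) (b ∷ d) = ≡.cong₂ _∷_ (ℕ.m+n∸m≡n a b) (⊕-⊖-cancelˡ c d)

≤ᵐ-refl : ∀ {n} {i : MultiIndex n} → Pointwise _≤_ i i
≤ᵐ-refl = Pointwise.refl ℕ.≤-refl

-- Power series of which only the coefficients at the i ≤ M are observed: here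
-- every series is a finite sum of monomials, so that the semiring laws reduce
-- to the case of monomials.
module Truncated {c ℓ₁ ℓ₂} (F : CharZeroField c ℓ₁ ℓ₂) {n : ℕ} (M : MultiIndex n) where

  open CharZeroField F hiding (zero; commutativeRing)
  open PowerSeries F
  open CommutativeRing (CharZeroField.commutativeRing F) using (+-commutativeMonoid)
  open BigOperator +-commutativeMonoid
  open import Relation.Binary.Reasoning.Setoid setoid

  infix 4 _≈ᵀ_

  record _≈ᵀ_ (f g : PS n) : Set ℓ₁ where
    constructor truncate
    field at : ∀ {i} → Pointwise _≤_ i M → f i ≈ g i
  open _≈ᵀ_ public

  ≋⇒≈ᵀ : ∀ {f g} → f ≋ g → f ≈ᵀ g
  ≋⇒≈ᵀ f≋g .at _ = f≋g _

  ≈ᵀ-isEquivalence : IsEquivalence _≈ᵀ_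
  ≈ᵀ-isEquivalence = record
    { refl  = ≋⇒≈ᵀ λ _ → refl
    ; sym   = λ f≈g → truncate λ i≤ → sym (at f≈g i≤)
    ; trans = λ f≈g g≈h → truncate λ i≤ → trans (at f≈g i≤) (at g≈h i≤)
    }

  +ᴾ-commutativeMonoid : CommutativeMonoid c ℓ₁
  +ᴾ-commutativeMonoid = record
    { Carrier = PS n ; _≈_ = _≈ᵀ_ ; _∙_ = _+ᴾ_ ; ε = 0ᴾ
    ; isCommutativeMonoid = record
      { isMonoid = record
        { isSemigroup = record
          { isMagma = record
            { isEquivalence = ≈ᵀ-isEquivalence
            ; ∙-cong = λ p q → truncate λ i≤ → +-cong (at p i≤) (at q i≤)
            }
          ; assoc = λ f g h → ≋⇒≈ᵀ λ i → +-assoc (f i) (g i) (h i)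
          }
        ; identity = (λ f → ≋⇒≈ᵀ λ i → +-identityˡ (f i)) , (λ f → ≋⇒≈ᵀ λ i → +-identityʳ (f i))
        }
      ; comm = λ f g → ≋⇒≈ᵀ λ i → +-comm (f i) (g i)
      }
    }

  private
    module + = CommutativeMonoid +ᴾ-commutativeMonoid
    module Big = BigOperator +ᴾ-commutativeMonoid

  -- The indices ≤ M are closed downwards, and the coefficient of a product at i involves only
  -- indices j and i ⊖ j, both ≤ i.
  *ᴾ-cong : ∀ {f f′ g g′} → f ≈ᵀ f′ → g ≈ᵀ g′ → f *ᴾ g ≈ᵀ f′ *ᴾ g′
  *ᴾ-cong p q .at {i} i≤ = big-cong (below i) λ {j} j∈ → *-cong
    (at p (Pointwise.trans ℕ.≤-trans (∈-below⁻ i j∈) i≤))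
    (at q (Pointwise.trans ℕ.≤-trans (⊖-≤ i j) i≤))

  monomial : Carrier → MultiIndex n → PS n
  monomial a c i = [ i ≟ c ] a

  monomial-cong : ∀ {a b c d} → a ≈ b → c ≡ d → monomial a c ≈ᵀ monomial b d
  monomial-cong a≈b ≡.refl .at {i} _ = []-cong (i ≟ _) (i ≟ _) (λ e → e) (λ e → e) (λ _ → a≈b)

  -- Only j = c can contribute to the convolution. The case split is forced by truncated
  -- subtraction: i ⊖ c = d amounts to i = c ⊕ d only when c ≤ i.
  monomial-* : ∀ a c b d → monomial a c *ᴾ monomial b d ≈ᵀ monomial (a * b) (c ⊕ d)
  monomial-* a c b d .at {i} _ with Pointwise.decidable ℕ._≤?_ c i
  ... | yes c≤i = begin
    big (below i) term
      ≈⟨ big-single term (below-unique i) (∈-below⁺ c≤i)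
           (λ {j} _ j≢c → trans (*-congʳ ([]-no (j ≟ c) j≢c)) (zeroˡ _)) ⟩
    [ c ≟ c ] a * [ i ⊖ c ≟ d ] b
      ≈⟨ *-congʳ ([]-yes (c ≟ c) ≡.refl) ⟩
    a * [ i ⊖ c ≟ d ] b
      ≈⟨ *-[] ⟩
    [ i ≟ c ⊕ d ] (a * b) ∎
    where
    term : MultiIndex n → Carrier
    term j = monomial a c j * monomial b d (i ⊖ j)
    *-[] : a * [ i ⊖ c ≟ d ] b ≈ [ i ≟ c ⊕ d ] (a * b)
    *-[] with i ⊖ c ≟ d
    ... | yes ≡.refl = sym ([]-yes (i ≟ _) (≡.sym (⊕-⊖ c≤i)))
    ... | no  ≢d     =
      trans (zeroʳ a) (sym ([]-no (i ≟ _) λ { ≡.refl → ≢d (⊕-⊖-cancelˡ c d) }))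
  ... | no  c≰i = trans
    (big-ε (below i) λ {j} j∈ →
      trans (*-congʳ ([]-no (j ≟ c) λ { ≡.refl → c≰i (∈-below⁻ i j∈) })) (zeroˡ _))
    (sym ([]-no (i ≟ c ⊕ d) λ { ≡.refl → c≰i (⊕-≤ˡ c d) }))

  record Additive (T : PS n → PS n) : Set (c ⊔ ℓ₁) where
    field
      cong   : ∀ {f g} → f ≈ᵀ g → T f ≈ᵀ T g
      0-homo : T 0ᴾ ≈ᵀ 0ᴾ
      +-homo : ∀ f g → T (f +ᴾ g) ≈ᵀ T f +ᴾ T g
  open Additive

  id-additive : Additive (λ f → f)
  id-additive = record { cong = λ p → p ; 0-homo = +.refl ; +-homo = λ _ _ → +.refl }

  ∘-additive : ∀ {T U} → Additive T → Additive U → Additive (T ∘ U)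
  ∘-additive T U = record
    { cong   = cong T ∘ cong U
    ; 0-homo = +.trans (cong T (0-homo U)) (0-homo T)
    ; +-homo = λ f g → +.trans (cong T (+-homo U f g)) (+-homo T _ _)
    }

  *ᴾ-additiveˡ : ∀ f → Additive (f *ᴾ_)
  *ᴾ-additiveˡ f = record
    { cong   = *ᴾ-cong (+.refl {f})
    ; 0-homo = ≋⇒≈ᵀ λ i → big-ε (below i) λ _ → zeroʳ _
    ; +-homo = λ g h → ≋⇒≈ᵀ λ i →
        trans (big-cong (below i) λ _ → distribˡ _ _ _) (big-∙ (below i) _ _)
    }

  *ᴾ-additiveʳ : ∀ f → Additive (_*ᴾ f)
  *ᴾ-additiveʳ f = record
    { cong   = λ p → *ᴾ-cong p (+.refl {f})
    ; 0-homo = ≋⇒≈ᵀ λ i → big-ε (below i) λ _ → zeroˡ _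
    ; +-homo = λ g h → ≋⇒≈ᵀ λ i →
        trans (big-cong (below i) λ _ → distribʳ _ _ _) (big-∙ (below i) _ _)
    }

  big-at : ∀ {b} {B : Set b} (xs : List B) (f : B → PS n) i → Big.big xs f i ≈ big xs (λ x → f x i)
  big-at []       f i = refl
  big-at (x ∷ xs) f i = +-congˡ (big-at xs f i)

  ∑-monomials : ∀ f → f ≈ᵀ Big.big (below M) (λ c → monomial (f c) c)
  ∑-monomials f .at {i} i≤M = sym (begin
    Big.big (below M) (λ c → monomial (f c) c) i
      ≈⟨ big-at (below M) (λ c → monomial (f c) c) i ⟩
    big (below M) (λ c → [ i ≟ c ] f c)
      ≈⟨ big-single (λ c → [ i ≟ c ] f c) (below-unique M) (∈-below⁺ i≤M)
           (λ {c} _ c≢i → []-no (i ≟ c) (c≢i ∘ ≡.sym)) ⟩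
    [ i ≟ i ] f i
      ≈⟨ []-yes (i ≟ i) ≡.refl ⟩
    f i ∎)

  -- Up to truncation every series is a finite sum of monomials, and additive operators commute with
  -- that sum.
  additive-ext : ∀ {T U} → Additive T → Additive U →
                 (∀ a c → T (monomial a c) ≈ᵀ U (monomial a c)) → ∀ f → T f ≈ᵀ U f
  additive-ext T U T≈U f = +.trans (sums T)
    (+.trans (Big.big-cong (below M) λ {c} _ → T≈U (f c) c) (+.sym (sums U)))
    where
    sums : ∀ {V} → Additive V → V f ≈ᵀ Big.big (below M) (λ c → V (monomial (f c) c))
    sums V = +.trans (cong V (∑-monomials f))
      (big-homo +ᴾ-commutativeMonoid +ᴾ-commutativeMonoid _ (0-homo V) (+-homo V) (below M) _)

  *ᴾ-comm : ∀ f g → f *ᴾ g ≈ᵀ g *ᴾ f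
  *ᴾ-comm f g =
    additive-ext (*ᴾ-additiveʳ g) (*ᴾ-additiveˡ g) (λ a c →
    additive-ext (*ᴾ-additiveˡ (monomial a c)) (*ᴾ-additiveʳ (monomial a c)) (λ b d →
    +.trans (monomial-* a c b d)
      (+.trans (monomial-cong (*-comm a b) (zipWith-comm ℕ.+-comm c d))
        (+.sym (monomial-* b d a c)))) g) f

  -- Three nested extensions, one per factor, reduce the law to monomials, where it is associativity
  -- of coefficients and of exponents.
  *ᴾ-assoc : ∀ f g h → (f *ᴾ g) *ᴾ h ≈ᵀ f *ᴾ (g *ᴾ h)
  *ᴾ-assoc f g h =
    additive-ext (∘-additive (*ᴾ-additiveʳ h) (*ᴾ-additiveʳ g)) (*ᴾ-additiveʳ (g *ᴾ h)) (λ x a →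
    let f = monomial x a in
    additive-ext (∘-additive (*ᴾ-additiveʳ h) (*ᴾ-additiveˡ f))
                 (∘-additive (*ᴾ-additiveˡ f) (*ᴾ-additiveʳ h)) (λ y b →
    let g = monomial y b in
    additive-ext (*ᴾ-additiveˡ (f *ᴾ g)) (∘-additive (*ᴾ-additiveˡ f) (*ᴾ-additiveˡ g)) (λ z c →
    +.trans (cong (*ᴾ-additiveʳ (monomial z c)) (monomial-* x a y b))
    (+.trans (monomial-* (x * y) (a ⊕ b) z c)
    (+.trans (monomial-cong (*-assoc x y z) (zipWith-assoc ℕ.+-assoc a b c))
    (+.trans (+.sym (monomial-* x a (y * z) (b ⊕ c)))
    (+.sym (cong (*ᴾ-additiveˡ f) (monomial-* y b z c))))))) h) g) f

  *ᴾ-identityˡ : ∀ f → 1ᴾ *ᴾ f ≈ᵀ f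
  *ᴾ-identityˡ = additive-ext (*ᴾ-additiveˡ 1ᴾ) id-additive λ a c →
    -- `1ᴾ` unfolds to `monomial 1# 𝟎`.
    +.trans (monomial-* 1# 𝟎 a c)
            (monomial-cong (*-identityˡ a) (zipWith-identityˡ ℕ.+-identityˡ c))

  commutativeSemiring : CommutativeSemiring c ℓ₁
  commutativeSemiring = record
    { Carrier = PS n ; _≈_ = _≈ᵀ_ ; _+_ = _+ᴾ_ ; _*_ = _*ᴾ_ ; 0# = 0ᴾ ; 1# = 1ᴾ
    ; isCommutativeSemiring = isCommutativeSemiringˡ record
      { +-isCommutativeMonoid = +.isCommutativeMonoid
      ; *-isCommutativeMonoid = record
        { isMonoid = record
          { isSemigroup = record
            { isMagma = record { isEquivalence = ≈ᵀ-isEquivalence ; ∙-cong = *ᴾ-cong }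
            ; assoc = *ᴾ-assoc
            }
          ; identity = *ᴾ-identityˡ , λ f → +.trans (*ᴾ-comm f 1ᴾ) (*ᴾ-identityˡ f)
          }
        ; comm = *ᴾ-comm
        }
      ; distribʳ = λ h f g → +-homo (*ᴾ-additiveʳ h) f g
      ; zeroˡ = λ h → 0-homo (*ᴾ-additiveʳ h)
      }
    }

  private
    module K = CommutativeSemiring commutativeSemiring

  open RawSemiringDefs K.rawSemiring using () renaming (_^_ to _^ᵀ_) public
  open TuplePower K.rawSemiring using () renaming (_^^_ to _^^ᵀ_) public
  open TuplePower rawSemiring using () renaming (_^^_ to _^^ᴿ_)

  -- Both powers iterate `_*ᴾ_`, but over raw semirings with different equalities; hence the
  -- induction on the exponent.
  ^≈^ᵀ : ∀ f k → RawSemiringDefs._^_ (rawSemiringᴾ n) f k ≈ᵀ f ^ᵀ k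
  ^≈^ᵀ f zero    = K.refl
  ^≈^ᵀ f (suc k) = K.*-congˡ (^≈^ᵀ f k)

  -- With the same series in every slot only the total degree of k matters; this is why μ enters the
  -- result through μ₁ + ⋯ + μₙ alone.
  ^^-constant : ∀ f {m} (k : MultiIndex m) → (λ _ → f) ^^ k ≈ᵀ f ^ᵀ ∣ k ∣
  ^^-constant f []      = K.refl
  ^^-constant f (a ∷ k) = K.trans (K.*-cong (^≈^ᵀ f a) (^^-constant f k))
                                  (K.sym (SemiringExp.^-homo-* K.semiring f a ∣ k ∣))

  -- The trailing factor at `rowSums Λ` lets the exponents accumulate as in `rowSums`, matching the
  -- recursion of `expand`.
  monomial-^-* : ∀ a c k b Λ → monomial a c ^ᵀ k *ᴾ monomial b (rowSums Λ) ≈ᵀ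
                 monomial (a ^ k * b) (rowSums (List.replicate k c ++ Λ))
  monomial-^-* a c zero    b Λ =
    K.trans (K.*-identityˡ _) (monomial-cong (sym (*-identityˡ b)) ≡.refl)
  monomial-^-* a c (suc k) b Λ =
    K.trans (K.*-assoc (monomial a c) (monomial a c ^ᵀ k) (monomial b (rowSums Λ)))
    (K.trans (K.*-congˡ {monomial a c} (monomial-^-* a c k b Λ))
    (K.trans (monomial-* a c _ _) (monomial-cong (sym (*-assoc a (a ^ k) b)) ≡.refl)))

  monomial-^^ : ∀ (w : MultiIndex n → Carrier) C κ →
                (λ j → monomial (w (lookup C j)) (lookup C j)) ^^ᵀ κ ≈ᵀ
                monomial ((w ∘ lookup C) ^^ᴿ κ) (rowSums (expand C κ))
  monomial-^^ w []      []      = K.refl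
  monomial-^^ w (c ∷ C) (k ∷ κ) = K.trans
    (K.*-congˡ {monomial (w c) c ^ᵀ k} (monomial-^^ w C κ))
    (monomial-^-* (w c) c k _ (expand C κ))

≤replicate : ∀ {n} (k : MultiIndex n) {L} → ∣ k ∣ ≤ L → Pointwise _≤_ k (replicate n L)
≤replicate []      _  = Pointwise.[]
≤replicate (a ∷ k) ≤L = ℕ.m+n≤o⇒m≤o a ≤L Pointwise.∷ ≤replicate k (ℕ.m+n≤o⇒n≤o a ≤L)

-- The composition formula

module Columns {n : ℕ} (i : MultiIndex n) where

  open DecTotalOrder (lexOrder n) using (totalOrder; antisym)
    renaming (_≤_ to _≤ˡ_; refl to ≤ˡ-refl)
  open Sort (lexOrder n) using (sort; sort-↭; sort-↗)

  private
    nonzero : List (MultiIndex n)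
    nonzero = filter (λ c → ¬? (c ≟ 𝟎)) (below i)

  columns : List (MultiIndex n)
  columns = sort nonzero

  columns-↗ : AllPairs _≤ˡ_ columns
  columns-↗ = Sorted⇒AllPairs totalOrder (sort-↗ nonzero)

  columns-unique : Unique columns
  columns-unique = Unique-resp-↭ (≡.setoid _) (↭⇒↭ₛ (↭-sym (sort-↭ nonzero)))
    (Unique.filter⁺ (λ c → ¬? (c ≟ 𝟎)) (below-unique i))

  ∈-columns⁺ : ∀ {c} → Pointwise _≤_ c i → c ≢ 𝟎 → c ∈ columns
  ∈-columns⁺ c≤i c≢𝟎 =
    ∈-resp-↭ (↭-sym (sort-↭ nonzero)) (∈-filter⁺ (λ c → ¬? (c ≟ 𝟎)) (∈-below⁺ c≤i) c≢𝟎)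

  ∈-columns⁻ : ∀ {c} → c ∈ columns → c ≢ 𝟎
  ∈-columns⁻ c∈ =
    proj₂ (∈-filter⁻ (λ c → ¬? (c ≟ 𝟎)) {xs = below i} (∈-resp-↭ (sort-↭ nonzero) c∈))

  expand-≢𝟎 : ∀ κ → All (_≢ 𝟎) (expand columns κ)
  expand-≢𝟎 κ = All.tabulate (∈-columns⁻ ∘ ∈-expand⁻ columns κ)

  expand-⊢ : ∀ κ → i ≡ rowSums (expand columns κ) → expand columns κ ⊢ i
  expand-⊢ κ i≡ =
    expand-≢𝟎 κ , AllPairs⇒Sorted totalOrder (expand-sorted ≤ˡ-refl κ columns-↗) , ≡.sym i≡

  -- Each nonzero column adds at least one to the total. Hence the box of side `∣ i ∣` misses no
  -- partition of i.
  ∣∣≤∣rowSums∣ : ∀ κ → ∣ κ ∣ ≤ ∣ rowSums (expand columns κ) ∣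
  ∣∣≤∣rowSums∣ κ =
    ≡.subst (_≤ ∣ rowSums (expand columns κ) ∣) (length-expand columns κ) (length≤ (expand-≢𝟎 κ))

  ⊢-expand : ∀ {Λ} → Λ ⊢ i → Λ ∈ map (expand columns) (below (replicate _ ∣ i ∣))
  ⊢-expand {Λ} (Λ≢𝟎 , Λ↗ , Λ≡i) with κ , ≡.refl ← expand-complete
      (λ p q → Pointwise.Pointwise-≡⇒≡ (antisym p q)) columns-↗
      (Sorted⇒AllPairs totalOrder Λ↗) columns-unique
      (All.tabulate λ c∈ → ∈-columns⁺
        (≡.subst (Pointwise _≤_ _) Λ≡i (All.lookup (columns≤ Λ) c∈)) (All.lookup Λ≢𝟎 c∈))
    = ∈-map⁺ (expand columns) (∈-below⁺ (≤replicate κ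
        (≡.subst (λ j → ∣ κ ∣ ≤ ∣ j ∣) Λ≡i (∣∣≤∣rowSums∣ κ))))

-- Division by factorials and grouping by total degree

module Scalars {c ℓ₁ ℓ₂} (F : CharZeroField c ℓ₁ ℓ₂) where

  open CharZeroField F hiding (zero; commutativeRing)
  open CommutativeRing (CharZeroField.commutativeRing F)
    using (+-commutativeMonoid; *-commutativeMonoid; commutativeSemiring)
  open SemiringMult semiring using (×1-homo-*; ×-assoc-*)
  open BigOperator +-commutativeMonoid
  open CommutativeSemigroupProperties (CommutativeMonoid.commutativeSemigroup *-commutativeMonoid)
    using (interchange; x∙yz≈y∙xz; xy∙z≈xz∙y)
  open TuplePower rawSemiring using (_^^_)
  open import Relation.Binary.Reasoning.Setoid setoid

  1/!_ : ℕ → Carrier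
  1/! l = (1/ (l !)) {{ l ℕ.!≢0 }}

  1/!ᵐ_ : ∀ {n} → MultiIndex n → Carrier
  1/!ᵐ k = (1/ (k !ᵐ)) {{ !ᵐ-nonZero k }}

  1/-inverse : ∀ n .{{_ : NonZero n}} → fromℕ n * 1/ n ≈ 1#
  1/-inverse n = trans (*-congʳ (sym n-0≈n)) (proj₂ (proj₂ (#⇒invertible (charZero n))))
    where
    n-0≈n : fromℕ n - 0# ≈ fromℕ n
    n-0≈n = trans (+-congˡ (trans (sym (+-identityˡ _)) (-‿inverseʳ 0#))) (+-identityʳ _)

  ·≈fromℕ* : ∀ m x → m · x ≈ fromℕ m * x
  ·≈fromℕ* m x = trans (sym (SemiringMult.×-congʳ semiring m (*-identityˡ x)))
                     (sym (×-assoc-* m 1# x))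

  -- The factor 1 is inserted as n · 1/n and removed as p · 1/p, so no multiplicativity of inverses
  -- is required. It turns `multinomial k` / l! into 1/k!, and later cancels the column factorials.
  /-cancelˡ : ∀ m n p .{{_ : NonZero n}} .{{_ : NonZero p}} → m ℕ.* n ≡ p →
              ∀ x → fromℕ m * x * 1/ p ≈ x * 1/ n
  /-cancelˡ m n p ≡.refl x = begin
    fromℕ m * x * 1/ p                          ≈⟨ *-identityʳ _ ⟨
    fromℕ m * x * 1/ p * 1#                     ≈⟨ *-congˡ (1/-inverse n) ⟨
    fromℕ m * x * 1/ p * (fromℕ n * 1/ n)       ≈⟨ *-congʳ (*-assoc (fromℕ m) x (1/ p)) ⟩
    fromℕ m * (x * 1/ p) * (fromℕ n * 1/ n)     ≈⟨ interchange _ _ _ _ ⟩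
    fromℕ m * fromℕ n * (x * 1/ p * 1/ n)       ≈⟨ *-cong (sym (×1-homo-* m n))
                                                         (xy∙z≈xz∙y x (1/ p) (1/ n)) ⟩
    fromℕ p * (x * 1/ n * 1/ p)                 ≈⟨ x∙yz≈y∙xz (fromℕ p) (x * 1/ n) (1/ p) ⟩
    x * 1/ n * (fromℕ p * 1/ p)                 ≈⟨ *-congˡ (1/-inverse p) ⟩
    x * 1/ n * 1#                               ≈⟨ *-identityʳ _ ⟩
    x * 1/ n                                    ∎

  []-* : ∀ {p} {P : Set p} (d : Dec P) {x} y → [ d ] x * y ≈ [ d ] (x * y)
  []-* (yes _) y = refl
  []-* (no _)  y = zeroˡ y

  ∑-*ʳ : ∀ {b} {B : Set b} (ys : List B) f x → ∑ ys f * x ≈ ∑ ys (λ y → f y * x)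
  ∑-*ʳ ys f x =
    big-homo +-commutativeMonoid +-commutativeMonoid (_* x) (zeroˡ x) (distribʳ x) ys f

  -- Each k is placed in the row l = |k| of a double sum. A k of degree above L has no row, so its
  -- term has to vanish.
  ∑-byDegree : ∀ {N} (ks : List (MultiIndex N)) L (a : MultiIndex N → Carrier) (b : ℕ → Carrier) →
               (∀ k → L < ∣ k ∣ → a k * b ∣ k ∣ ≈ 0#) →
               ∑ ks (λ k → a k * b ∣ k ∣) ≈
               ∑ (upTo (suc L)) (λ l → ∑ ks (λ k → [ ∣ k ∣ ℕ.≟ l ] a k) * b l)
  ∑-byDegree ks L a b high = begin
    ∑ ks (λ k → a k * b ∣ k ∣)
      ≈⟨ big-cong ks (λ {k} _ → diagonal k) ⟩
    ∑ ks (λ k → ∑ (upTo (suc L)) (λ l → [ ∣ k ∣ ℕ.≟ l ] (a k * b l)))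
      ≈⟨ big-swap ks (upTo (suc L)) _ ⟩
    ∑ (upTo (suc L)) (λ l → ∑ ks (λ k → [ ∣ k ∣ ℕ.≟ l ] (a k * b l)))
      ≈⟨ big-cong (upTo (suc L)) (λ {l} _ → trans
           (big-cong ks λ {k} _ → sym ([]-* (∣ k ∣ ℕ.≟ l) (b l))) (sym (∑-*ʳ ks _ (b l)))) ⟩
    ∑ (upTo (suc L)) (λ l → ∑ ks (λ k → [ ∣ k ∣ ℕ.≟ l ] a k) * b l) ∎
    where
    diagonal : ∀ k → a k * b ∣ k ∣ ≈ ∑ (upTo (suc L)) (λ l → [ ∣ k ∣ ℕ.≟ l ] (a k * b l))
    diagonal k with ∣ k ∣ ℕ.≤? L
    ... | yes k≤L = sym (trans
      (big-single _ (Unique.upTo⁺ (suc L)) (∈-upTo⁺ (s≤s k≤L))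
        λ {l} _ l≢k → []-no (∣ k ∣ ℕ.≟ l) (l≢k ∘ ≡.sym))
      ([]-yes (∣ k ∣ ℕ.≟ ∣ k ∣) ≡.refl))
    ... | no  k≰L = trans (high k (ℕ.≰⇒> k≰L))
      (sym (big-ε (upTo (suc L)) λ {l} l∈ → []-no (∣ k ∣ ℕ.≟ l)
         λ { ≡.refl → k≰L (ℕ.s≤s⁻¹ (∈-upTo⁻ l∈)) }))

  fromℕ-^ : ∀ m k → fromℕ (m ℕ.^ k) ≈ fromℕ m ^ k
  fromℕ-^ m zero    = +-identityʳ 1#
  fromℕ-^ m (suc k) = trans (×1-homo-* m (m ℕ.^ k)) (*-congˡ (fromℕ-^ m k))

  -- Clears denominators: for w c = h_c / c! and q c = c!, the product of the (c!)^κ_c is Λ!, and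
  -- what remains is h_Λ. The `sum` over the multiplicative monoid is a product.
  ^^-*fromℕ : ∀ {x} {X : Set x} (w h : X → Carrier) (q : X → ℕ) C →
              (∀ {c} → c ∈ C → w c * fromℕ (q c) ≈ h c) → ∀ κ →
              (w ∘ lookup C) ^^ κ *
                fromℕ (RawMonoidDefs.sum ℕ.*-1-rawMonoid (λ j → q (lookup C j) ℕ.^ lookupᵐ κ j)) ≈
              (h ∘ lookup C) ^^ κ
  ^^-*fromℕ w h q []      w≈h []      = trans (*-identityˡ _) (+-identityʳ 1#)
  ^^-*fromℕ w h q (c ∷ C) w≈h (k ∷ κ) = begin
    w c ^ k * W * fromℕ (q c ℕ.^ k ℕ.* Q)          ≈⟨ *-congˡ (×1-homo-* (q c ℕ.^ k) Q) ⟩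
    w c ^ k * W * (fromℕ (q c ℕ.^ k) * fromℕ Q)    ≈⟨ interchange _ _ _ _ ⟩
    w c ^ k * fromℕ (q c ℕ.^ k) * (W * fromℕ Q)    ≈⟨ *-cong (*-congˡ (fromℕ-^ (q c) k))
                                                        (^^-*fromℕ w h q C (w≈h ∘ there) κ) ⟩
    w c ^ k * fromℕ (q c) ^ k * (h ∘ lookup C) ^^ κ ≈⟨ *-congʳ (^-distrib-* (w c) (fromℕ (q c)) k) ⟨
    (w c * fromℕ (q c)) ^ k * (h ∘ lookup C) ^^ κ  ≈⟨ *-congʳ (^-congˡ k (w≈h (here ≡.refl))) ⟩
    h c ^ k * (h ∘ lookup C) ^^ κ                  ∎
    where
    open CommutativeSemiringExp commutativeSemiring using (^-distrib-*)
    open SemiringExp semiring using (^-congˡ)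
    W = (w ∘ lookup C) ^^ κ
    Q = RawMonoidDefs.sum ℕ.*-1-rawMonoid (λ j → q (lookup C j) ℕ.^ lookupᵐ κ j)

  module _ {k ℓ} (K : CommutativeSemiring k ℓ) where

    private
      module K = CommutativeSemiring K
      module K+ = BigOperator K.+-commutativeMonoid
    open RawSemiringDefs K.rawSemiring using (sum; _×_) renaming (_^_ to _^ᴷ_)
    open TuplePower K.rawSemiring using () renaming (_^^_ to _^^ᴷ_)

    -- Serves twice: with φ = E on R[A], and with φ the coefficient at i on truncated series.
    multinomial/! : (φ : K.Carrier → Carrier) → (∀ {x y} → x K.≈ y → φ x ≈ φ y) →
                    φ K.0# ≈ 0# → (∀ x y → φ (x K.+ y) ≈ φ x + φ y) →
                    ∀ {N} (x : Vector K.Carrier N) {l L} → l ≤ L →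
                    φ (sum x ^ᴷ l) * 1/! l ≈
                    ∑ (below (replicate N L)) (λ k → [ ∣ k ∣ ℕ.≟ l ] (φ (x ^^ᴷ k) * 1/!ᵐ k))
    multinomial/! φ φ-cong φ-0 φ-+ x {l} {L} l≤L = begin
      φ (sum x ^ᴷ l) * 1/! l
        ≈⟨ *-congʳ (φ-cong (MultinomialTheorem.multinomialTheorem K x l≤L)) ⟩
      φ (K+.big ks (λ k →
        K+.[ ∣ k ∣ ℕ.≟ l ] (multinomial k × (x ^^ᴷ k)))) * 1/! l
        ≈⟨ *-congʳ (big-homo K.+-commutativeMonoid +-commutativeMonoid φ φ-0 φ-+ ks _) ⟩
      ∑ ks (λ k → φ (K+.[ ∣ k ∣ ℕ.≟ l ] (multinomial k × (x ^^ᴷ k)))) * 1/! l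
        ≈⟨ ∑-*ʳ ks _ (1/! l) ⟩
      ∑ ks (λ k → φ (K+.[ ∣ k ∣ ℕ.≟ l ] (multinomial k × (x ^^ᴷ k))) * 1/! l)
        ≈⟨ big-cong ks (λ {k} _ → term k) ⟩
      ∑ ks (λ k → [ ∣ k ∣ ℕ.≟ l ] (φ (x ^^ᴷ k) * 1/!ᵐ k)) ∎
      where
      ks = below (replicate _ L)
      φ-× : ∀ m y → φ (m × y) ≈ m · φ y
      φ-× zero    y = φ-0
      φ-× (suc m) y = trans (φ-+ y (m × y)) (+-congˡ (φ-× m y))
      φ-[]-* : ∀ {p} {P : Set p} (d : Dec P) {y r z} → (P → φ y * r ≈ z) →
               φ (K+.[ d ] y) * r ≈ [ d ] z
      φ-[]-* (no _)  _   = trans (*-congʳ φ-0) (zeroˡ _)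
      φ-[]-* (yes p) y≈z = y≈z p
      term : ∀ k → φ (K+.[ ∣ k ∣ ℕ.≟ l ] (multinomial k × (x ^^ᴷ k))) * 1/! l ≈
             [ ∣ k ∣ ℕ.≟ l ] (φ (x ^^ᴷ k) * 1/!ᵐ k)
      term k = φ-[]-* (∣ k ∣ ℕ.≟ l) λ { ≡.refl →
        trans (*-congʳ (trans (φ-× (multinomial k) _) (·≈fromℕ* (multinomial k) _)))
          (/-cancelˡ (multinomial k) (k !ᵐ) (l !) {{ !ᵐ-nonZero k }} {{ l ℕ.!≢0 }}
            (multinomial*!≡sum! k) _) }

𝟎!ᵐ≡1 : ∀ n → 𝟎 {n} !ᵐ ≡ 1
𝟎!ᵐ≡1 zero    = ≡.refl
𝟎!ᵐ≡1 (suc n) = ≡.trans (ℕ.+-identityʳ _) (𝟎!ᵐ≡1 n)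

∈-partitions⁻ : ∀ {n} {i : MultiIndex n} {Λ} → Λ ∈ partitions i → Λ ⊢ i
∈-partitions⁻ {i = i} Λ∈ =
  proj₂ (∈-filter⁻ (_⊢? i) {xs = concatMap (words (below i)) (upTo (suc ∣ i ∣))} Λ∈)

[]⊢𝟎 : ∀ {n} → [] ⊢ 𝟎 {n}
[]⊢𝟎 {n} = [] , AllPairs⇒Sorted (DecTotalOrder.totalOrder (lexOrder n)) [] , ≡.refl

⊢𝟎⇒≡[] : ∀ {n Λ} → Λ ⊢ 𝟎 {n} → Λ ≡ []
⊢𝟎⇒≡[] {Λ = []}    _ = ≡.refl
⊢𝟎⇒≡[] {n} {Λ = c ∷ Λ} (Λ≢𝟎 , _ , eq) =
  contradiction (≡.subst (suc (length Λ) ≤_) (≡.trans (≡.cong ∣_∣ eq) (sum-𝟎 n)) (length≤ Λ≢𝟎)) λ ()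

∏!≡!ᵐ : ∀ {n} (κ : MultiIndex n) → RawMonoidDefs.sum ℕ.*-1-rawMonoid (λ j → lookupᵐ κ j !) ≡ κ !ᵐ
∏!≡!ᵐ []      = ≡.refl
∏!≡!ᵐ (k ∷ κ) = ≡.cong (k ! ℕ.*_) (∏!≡!ᵐ κ)

-- Comparison of the coefficients at a fixed index

module CompositionFormula {c ℓ₁ ℓ₂ a} (F : CharZeroField c ℓ₁ ℓ₂) (A : Set a)
  (E : Umbral.R[A] F A → CharZeroField.Carrier F) (isEvaluation : Umbral.IsEvaluation F A E) where

  open CharZeroField F hiding (zero; commutativeRing) renaming (Carrier to R)
  open Umbral F A using (R[A]; IsEvaluation; sumᵗ; _^^ᵗ_; module Evaluation) renaming (_^_ to _^ᵁ_)
  open PowerSeries F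
  open CommutativeRing (CharZeroField.commutativeRing F)
    using (+-commutativeMonoid; *-commutativeMonoid; commutativeSemiring; +-group)
  open Scalars F
  open Evaluation E
  open BigOperator +-commutativeMonoid
  open TuplePower rawSemiring using () renaming (_^^_ to _^^ᴿ_)
  open CommutativeSemigroupProperties (CommutativeMonoid.commutativeSemigroup *-commutativeMonoid)
    using (xy∙z≈xz∙y)
  open import Relation.Binary.Reasoning.Setoid setoid
  open IsEvaluation isEvaluation using (isLinear; unital)
  open IsLeftModuleHomomorphism isLinear using (⟦⟧-cong; +ᴹ-homo; 0ᴹ-homo)
  private
    module U = CommutativeRing (Umbral.commutativeRing F A)

  1/≈1 : ∀ m .{{_ : NonZero m}} → m ≡ 1 → 1/ m ≈ 1#
  1/≈1 m m≡1 = begin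
    1/ m            ≈⟨ *-identityˡ _ ⟨
    1# * 1/ m       ≈⟨ *-congʳ (+-identityʳ 1#) ⟨
    fromℕ 1 * 1/ m  ≈⟨ *-congʳ (reflexive (≡.cong fromℕ m≡1)) ⟨
    fromℕ m * 1/ m  ≈⟨ 1/-inverse m ⟩
    1#              ∎

  -- `egf` sets the constant coefficient to 1 whatever m is; the uniform formula holds there because
  -- m 𝟎 ≈ 1 and 𝟎! = 1.
  egf-coefficient : ∀ {n} (m : MultiIndex n → R) → m 𝟎 ≈ 1# → ∀ i → egf m i ≈ m i * 1/!ᵐ i
  egf-coefficient {n} m m𝟎≈1 i with i ≟ 𝟎
  ... | yes ≡.refl = sym (trans
    (*-cong m𝟎≈1 (1/≈1 (𝟎 {n} !ᵐ) {{ !ᵐ-nonZero (𝟎 {n}) }} (𝟎!ᵐ≡1 n)))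
    (*-identityˡ 1#))
  ... | no  _      = refl

  moment-𝟎 : ∀ {n} (μ : Vector R[A] n) → moment μ 𝟎 ≈ 1#
  moment-𝟎 μ = trans (⟦⟧-cong (^^-𝟎 μ)) unital
    where
    ^^-𝟎 : ∀ {n} (μ : Vector R[A] n) → μ ^^ᵗ 𝟎 U.≈ U.1#
    ^^-𝟎 {zero}  μ = U.refl
    ^^-𝟎 {suc n} μ = U.trans (U.*-identityˡ _) (^^-𝟎 (μ ∘ suc))

  module _ {n : ℕ} (μ ν : Vector R[A] n) (i : MultiIndex n) where

    open Columns i
    open Truncated F i
    private
      module K = CommutativeSemiring (Truncated.commutativeSemiring F i)
      module Big = BigOperator K.+-commutativeMonoid

    N = length columns
    L = ∣ i ∣

    s : PS n
    s = egf (moment ν) -ᴾ 1ᴾ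

    p^_ : ℕ → R
    p^ l = E (sumᵗ μ ^ᵁ l)

    x : Vector (PS n) N
    x j = monomial (s (lookup columns j)) (lookup columns j)

    -- The product x^κ is the single monomial with coefficient `W κ` and exponent `rows κ`.
    W : MultiIndex N → R
    W κ = (s ∘ lookup columns) ^^ᴿ κ

    rows : MultiIndex N → MultiIndex n
    rows κ = rowSums (expand columns κ)

    s-nonzero : ∀ {c} → c ≢ 𝟎 → s c ≈ moment ν c * 1/!ᵐ c
    s-nonzero {c} c≢𝟎 with c ≟ 𝟎
    ... | yes c≡𝟎 = contradiction c≡𝟎 c≢𝟎
    ... | no  _   = trans (+-congˡ (GroupProperties.ε⁻¹≈ε +-group)) (+-identityʳ _)

    sum-lookup : ∀ (C : List (MultiIndex n)) (f : MultiIndex n → PS n) →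
                 RawMonoidDefs.sum K.+-rawMonoid (f ∘ lookup C) ≈ᵀ Big.big C f
    sum-lookup []      f = K.refl
    sum-lookup (c ∷ C) f = K.+-congˡ {f c} (sum-lookup C f)

    s-expansion : s ≈ᵀ RawMonoidDefs.sum K.+-rawMonoid x
    s-expansion = K.trans (truncate coefficient)
      (K.sym (sum-lookup columns (λ c → monomial (s c) c)))
      where
      coefficient : ∀ {j} → Pointwise _≤_ j i → s j ≈ Big.big columns (λ c → monomial (s c) c) j
      coefficient {j} j≤i = trans (value (j ≟ 𝟎)) (sym (big-at columns (λ c → monomial (s c) c) j))
        where
        value : Dec (j ≡ 𝟎) → s j ≈ big columns (λ c → [ j ≟ c ] s c)
        -- No column is 𝟎, in accordance with s having no constant term.
        value (yes ≡.refl) = trans (egf-1-noConstantTerm (moment ν))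
          (sym (big-ε columns λ {c} c∈ → []-no (𝟎 ≟ c) (∈-columns⁻ c∈ ∘ ≡.sym)))
        value (no  j≢𝟎)    = sym (trans
          (big-single _ columns-unique (∈-columns⁺ j≤i j≢𝟎)
            λ {c} _ c≢j → []-no (j ≟ c) (c≢j ∘ ≡.sym))
          ([]-yes (j ≟ j) ≡.refl))

    b : MultiIndex N → R
    b κ = (x ^^ᵀ κ) i * 1/!ᵐ κ

    b-value : ∀ κ → b κ ≈ [ i ≟ rows κ ] W κ * 1/!ᵐ κ
    b-value κ = *-congʳ (at (monomial-^^ s columns κ) ≤ᵐ-refl)

    s^/! : ∀ {l} → l ≤ L →
           (s ^ᵀ l) i * 1/! l ≈ ∑ (below (replicate N L)) (λ κ → [ ∣ κ ∣ ℕ.≟ l ] b κ)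
    s^/! {l} l≤L = trans
      (*-congʳ (at (SemiringExp.^-congˡ K.semiring l s-expansion) ≤ᵐ-refl))
      (multinomial/! (Truncated.commutativeSemiring F i) (λ f → f i) (λ f≈g → at f≈g ≤ᵐ-refl)
        refl (λ _ _ → refl) x l≤L)

    substitution-expansion :
      subst (egf (moment μ)) (λ _ → s) (λ _ → egf-1-noConstantTerm (moment ν)) i ≈
      ∑ (below (replicate N L)) (λ κ → b κ * p^ ∣ κ ∣)
    substitution-expansion = begin
      ∑ ks (λ k → egf (moment μ) k * ((λ _ → s) ^^ k) i)
        ≈⟨ big-cong ks (λ {k} _ → *-cong (egf-coefficient (moment μ) (moment-𝟎 μ) k)
             (at (^^-constant s k) ≤ᵐ-refl)) ⟩
      ∑ ks (λ k → weight k * (s ^ᵀ ∣ k ∣) i)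
        -- The box may contain k with |k| > |i|, but then s^|k| has order above |i| and no
        -- coefficient at i.
        ≈⟨ ∑-byDegree ks L weight (λ l → (s ^ᵀ l) i) (λ k L<k → trans
             (*-congˡ (trans (sym (at (^^-constant s k) ≤ᵐ-refl))
               (^^-vanishes (λ _ → s) (λ _ → egf-1-noConstantTerm (moment ν)) k i L<k)))
             (zeroʳ _)) ⟩
      ∑ (upTo (suc L)) (λ l → ∑ ks (λ k → [ ∣ k ∣ ℕ.≟ l ] weight k) * (s ^ᵀ l) i)
        ≈⟨ big-cong (upTo (suc L)) (λ {l} l∈ → exchange (ℕ.s≤s⁻¹ (∈-upTo⁻ l∈))) ⟩
      ∑ (upTo (suc L)) (λ l → ∑ κs (λ κ → [ ∣ κ ∣ ℕ.≟ l ] b κ) * p^ l)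
        -- The grouping read backwards: if |κ| > |i|, the row sums of κ differ from i and `b κ`
        -- vanishes.
        ≈⟨ ∑-byDegree κs L b p^_ (λ κ L<κ → trans
             (*-congʳ (trans (b-value κ) (trans (*-congʳ ([]-no (i ≟ rows κ) λ i≡ →
               ℕ.<⇒≱ L<κ (≡.subst (λ j → ∣ κ ∣ ≤ ∣ j ∣) (≡.sym i≡) (∣∣≤∣rowSums∣ κ)))) (zeroˡ _))))
             (zeroˡ _)) ⟨
      ∑ κs (λ κ → b κ * p^ ∣ κ ∣) ∎
      where
      ks = below (replicate n L)
      κs = below (replicate N L)
      weight : MultiIndex n → R
      weight k = moment μ k * 1/!ᵐ k
      -- Both sides are E[pˡ] (sˡ)ᵢ / l!. The single factor 1/l! first belongs to E[pˡ], through the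
      -- multinomial theorem in R[A], and is then handed over to sˡ.
      exchange : ∀ {l} → l ≤ L → ∑ ks (λ k → [ ∣ k ∣ ℕ.≟ l ] weight k) * (s ^ᵀ l) i ≈
                 ∑ κs (λ κ → [ ∣ κ ∣ ℕ.≟ l ] b κ) * p^ l
      exchange {l} l≤L = begin
        ∑ ks (λ k → [ ∣ k ∣ ℕ.≟ l ] weight k) * (s ^ᵀ l) i
          ≈⟨ *-congʳ (multinomial/! U.commutativeSemiring E ⟦⟧-cong 0ᴹ-homo +ᴹ-homo μ l≤L) ⟨
        p^ l * 1/! l * (s ^ᵀ l) i
          ≈⟨ trans (*-assoc _ _ _) (*-comm _ _) ⟩
        1/! l * (s ^ᵀ l) i * p^ l
          ≈⟨ *-congʳ (trans (*-comm _ _) (s^/! l≤L)) ⟩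
        ∑ κs (λ κ → [ ∣ κ ∣ ℕ.≟ l ] b κ) * p^ l ∎

    -- The summand without i!, which cancels against the 1/i! of the generating function.
    partitionTerm : List (MultiIndex n) → R
    partitionTerm Λ = (1/ (𝔪[ Λ ]! ℕ.* Λ !ᵖ)) {{ 𝔪!*!ᵖ-nonZero Λ }} * p^ (length Λ) * h ν Λ

    -- Here Λ! = Q and h_Λ = `W κ` · Q, so Q cancels and only κ! = 𝔪(Λ)! stays in the denominator.
    partitionTerm-expand : ∀ κ → partitionTerm (expand columns κ) ≈ W κ * 1/!ᵐ κ * p^ ∣ κ ∣
    partitionTerm-expand κ = begin
      1/m!Λ! * p^ (length Λ) * h ν Λ
        ≈⟨ *-cong (*-congˡ (reflexive (≡.cong p^_ (length-expand columns κ)))) h≈ ⟩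
      1/m!Λ! * p^ ∣ κ ∣ * (W κ * fromℕ Q)
        ≈⟨ trans (xy∙z≈xz∙y _ _ _) (*-congʳ (trans (*-comm _ _) (*-congʳ (*-comm _ _)))) ⟩
      fromℕ Q * W κ * 1/m!Λ! * p^ ∣ κ ∣
        ≈⟨ *-congʳ (/-cancelˡ Q (κ !ᵐ) (𝔪[ Λ ]! ℕ.* Λ !ᵖ) {{ !ᵐ-nonZero κ }} {{ 𝔪!*!ᵖ-nonZero Λ }}
             (≡.trans (ℕ.*-comm Q (κ !ᵐ)) (≡.sym (≡.cong₂ ℕ._*_ 𝔪!≡ !ᵖ≡))) (W κ)) ⟩
      W κ * 1/!ᵐ κ * p^ ∣ κ ∣ ∎
      where
      open Multiplicity (_≟_ {n}) using (big-deduplicate)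
      Λ = expand columns κ
      1/m!Λ! = (1/ (𝔪[ Λ ]! ℕ.* Λ !ᵖ)) {{ 𝔪!*!ᵖ-nonZero Λ }}
      Q = RawMonoidDefs.sum ℕ.*-1-rawMonoid (λ j → lookup columns j !ᵐ ℕ.^ lookupᵐ κ j)
      𝔪!≡ : 𝔪[ Λ ]! ≡ κ !ᵐ
      𝔪!≡ = ≡.trans
        (big-deduplicate ℕ.*-1-commutativeMonoid (λ _ k → k !) (λ _ → ≡.refl) columns-unique κ)
        (∏!≡!ᵐ κ)
      !ᵖ≡ : Λ !ᵖ ≡ Q
      !ᵖ≡ =
        big-deduplicate ℕ.*-1-commutativeMonoid (λ c k → c !ᵐ ℕ.^ k) (λ _ → ≡.refl) columns-unique κ
      h≈ : h ν Λ ≈ W κ * fromℕ Q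
      h≈ = trans
        (big-deduplicate *-commutativeMonoid (λ c k → moment ν c ^ k) (λ _ → refl) columns-unique κ)
        (sym (^^-*fromℕ s (moment ν) _!ᵐ columns (λ {c} c∈ → begin
          s c * fromℕ (c !ᵐ)
            ≈⟨ *-congʳ (s-nonzero (∈-columns⁻ c∈)) ⟩
          moment ν c * 1/!ᵐ c * fromℕ (c !ᵐ)
            ≈⟨ *-assoc _ _ _ ⟩
          moment ν c * (1/!ᵐ c * fromℕ (c !ᵐ))
            ≈⟨ *-congˡ (trans (*-comm _ _) (1/-inverse (c !ᵐ) {{ !ᵐ-nonZero c }})) ⟩
          moment ν c * 1#
            ≈⟨ *-identityʳ _ ⟩
          moment ν c ∎) κ))

    auxiliary-expansion :
      (sumᵗ μ ∙β∙ ν) i * 1/!ᵐ i ≈ ∑ (below (replicate N L)) (λ κ → b κ * p^ ∣ κ ∣)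
    auxiliary-expansion = begin
      (sumᵗ μ ∙β∙ ν) i * 1/!ᵐ i
        ≈⟨ ∑-*ʳ (partitions i) _ (1/!ᵐ i) ⟩
      ∑ (partitions i) (λ Λ → fromℕ (i !ᵐ) * (1/ (𝔪[ Λ ]! ℕ.* Λ !ᵖ)) {{ 𝔪!*!ᵖ-nonZero Λ }}
        * p^ (length Λ) * h ν Λ * 1/!ᵐ i)
        -- The guard holds on every partition of i; it is inserted so that the summand vanishes on
        -- expansions with other row sums, which allows the change of index list.
        ≈⟨ big-cong (partitions i) (λ {Λ} Λ∈ → trans (cancel-i! _ _ _)
             (sym ([]-yes (i ≟ rowSums Λ) (≡.sym (proj₂ (proj₂ (∈-partitions⁻ Λ∈))))))) ⟩
      ∑ (partitions i) filteredTerm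
        ≈⟨ big-support (List.≡-dec _≟_) filteredTerm (partitions-unique i)
             (Unique.map⁺ (expand-injective columns-unique _ _) (below-unique (replicate N L)))
             (λ Λ∈ Λ∉ → contradiction (⊢-expand (∈-partitions⁻ Λ∈)) Λ∉)
             (λ {Λ} Λ∈ Λ∉ → []-no (i ≟ rowSums Λ) λ i≡ → Λ∉ (expanded∈ Λ∈ i≡)) ⟩
      ∑ (map (expand columns) κs) filteredTerm
        ≈⟨ big-map (expand columns) κs filteredTerm ⟩
      ∑ κs (λ κ → [ i ≟ rows κ ] partitionTerm (expand columns κ))
        ≈⟨ big-cong κs (λ {κ} _ → term κ) ⟩
      ∑ κs (λ κ → b κ * p^ ∣ κ ∣) ∎
      where
      open Multiplicity (_≟_ {n}) using (expand-injective)
      κs = below (replicate N L)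
      filteredTerm : List (MultiIndex n) → R
      filteredTerm Λ = [ i ≟ rowSums Λ ] partitionTerm Λ
      cancel-i! : ∀ u v w → fromℕ (i !ᵐ) * u * v * w * 1/!ᵐ i ≈ u * v * w
      cancel-i! u v w = begin
        fromℕ (i !ᵐ) * u * v * w * 1/!ᵐ i
          ≈⟨ *-congʳ (trans (*-congʳ (*-assoc _ _ _)) (*-assoc _ _ _)) ⟩
        fromℕ (i !ᵐ) * (u * v * w) * 1/!ᵐ i
          ≈⟨ xy∙z≈xz∙y _ _ _ ⟩
        fromℕ (i !ᵐ) * 1/!ᵐ i * (u * v * w)
          ≈⟨ *-congʳ (1/-inverse (i !ᵐ) {{ !ᵐ-nonZero i }}) ⟩
        1# * (u * v * w)
          ≈⟨ *-identityˡ _ ⟩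
        u * v * w ∎
      expanded∈ : ∀ {Λ} → Λ ∈ map (expand columns) κs → i ≡ rowSums Λ → Λ ∈ partitions i
      expanded∈ Λ∈ i≡ with κ , _ , ≡.refl ← ∈-map⁻ (expand columns) Λ∈
        = ∈-partitions (expand-⊢ κ i≡)
      term : ∀ κ → [ i ≟ rows κ ] partitionTerm (expand columns κ) ≈ b κ * p^ ∣ κ ∣
      term κ = begin
        [ i ≟ rows κ ] partitionTerm (expand columns κ)
          ≈⟨ []-cong (i ≟ rows κ) (i ≟ rows κ) (λ e → e) (λ e → e) (λ _ → partitionTerm-expand κ) ⟩
        [ i ≟ rows κ ] (W κ * 1/!ᵐ κ * p^ ∣ κ ∣)
          ≈⟨ []-* (i ≟ rows κ) (p^ ∣ κ ∣) ⟨
        [ i ≟ rows κ ] (W κ * 1/!ᵐ κ) * p^ ∣ κ ∣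
          ≈⟨ *-congʳ ([]-* (i ≟ rows κ) (1/!ᵐ κ)) ⟨
        [ i ≟ rows κ ] W κ * 1/!ᵐ κ * p^ ∣ κ ∣
          ≈⟨ *-congʳ (b-value κ) ⟨
        b κ * p^ ∣ κ ∣ ∎

  -- Only the empty matrix partitions 𝟎, and its term is E[p⁰] = 1; so `egf-coefficient` applies to
  -- the auxiliary umbra.
  auxiliary-𝟎 : ∀ {n} (p : R[A]) (ν : Vector R[A] n) → (p ∙β∙ ν) 𝟎 ≈ 1#
  auxiliary-𝟎 {n} p ν = trans
    (big-single (λ Λ → fromℕ (𝟎 {n} !ᵐ) * (1/ (𝔪[ Λ ]! ℕ.* Λ !ᵖ)) {{ 𝔪!*!ᵖ-nonZero Λ }}
        * E (p ^ᵁ length Λ) * h ν Λ)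
      (partitions-unique (𝟎 {n})) (∈-partitions []⊢𝟎)
      (λ Λ∈ Λ≢[] → contradiction (⊢𝟎⇒≡[] (∈-partitions⁻ Λ∈)) Λ≢[]))
    (begin
      -- On the empty list `𝔪[_]!` and `_!ᵖ` compute to 1, and `h` to `1#`.
      fromℕ (𝟎 {n} !ᵐ) * 1/ 1 * E (p ^ᵁ 0) * 1#  ≈⟨ *-identityʳ _ ⟩
      fromℕ (𝟎 {n} !ᵐ) * 1/ 1 * E (p ^ᵁ 0)
        ≈⟨ *-cong (*-cong (trans (reflexive (≡.cong fromℕ (𝟎!ᵐ≡1 n))) (+-identityʳ 1#))
             (1/≈1 1 ≡.refl)) unital ⟩
      1# * 1# * 1#                               ≈⟨ trans (*-identityʳ _) (*-identityʳ _) ⟩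
      1#                                         ∎)

theorem3p3 : ∀ {c ℓ₁ ℓ₂ a} (F : CharZeroField c ℓ₁ ℓ₂) (A : Set a) →
    let open CharZeroField F using () renaming (Carrier to R)
        open PowerSeries F
        open Umbral F A
    in (E : R[A] → R) → IsEvaluation E →
    let open Evaluation E in
    (n : ℕ) (μ ν : Vector R[A] n) →
    (∀ j → IsMonomial (μ j)) → (∀ j → IsMonomial (ν j)) →
    egf (sumᵗ μ ∙β∙ ν) ≋
      subst (egf (moment μ)) (λ _ → egf (moment ν) -ᴾ 1ᴾ) (λ _ → egf-1-noConstantTerm (moment ν))
theorem3p3 F A E isEvaluation n μ ν _ _ i =
  trans (egf-coefficient (sumᵗ μ ∙β∙ ν) (auxiliary-𝟎 (sumᵗ μ) ν) i)
    (trans (auxiliary-expansion μ ν i) (sym (substitution-expansion μ ν i)))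
  where
  open CharZeroField F using (trans; sym)
  open CompositionFormula F A E isEvaluation
  open Umbral F A using (sumᵗ; module Evaluation)
  open Evaluation E using (_∙β∙_)
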